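{- Let $G$ be a finite abstract simplicial complex with $n$ elements and Dirac matrix $D$. Let $\lambda_1\ge\lambda_2\ge\cdots\ge\lambda_n$ be the eigenvalues of $D$ (with multiplicity) and let $d_1\ge d_2\ge\cdots\ge d_n$ be the vertex degrees of the Dirac graph of $G$, both in descending order. Then $\lambda_j\le d_j$ for all $1\le j\le n$. The same holds for open sets: if $U\subset G$ is open, then the descending ordered eigenvalues of $D_U$ are bounded above, index by index, by the descending ordered vertex degrees of the Dirac graph of $U$.
   Context: A finite abstract simplicial complex $G$ is a finite set of non-empty finite sets (simplices) closed under taking non-empty subsets. A set $U\subset G$ is open if $x\in U$, $y\in G$, $x\subset y$ imply $y\in U$. Fix an ordering of the vertices of each simplex. For $y\subset x$ with $|x|=|y|+1$, $\mathrm{sign}(x,y)\in\{1,-1\}$ is the sign of the permutation that takes the list $(v,y)$ ($v$ the vertex in $x\setminus y$, followed by the ordered vertices of $y$) to the ordered list of vertices of $x$. The exterior derivative $d$ is the matrix indexed by $G\times G$ with $d(x,y)=\mathrm{sign}(x,y)$ if $y\subset x$ and $|x|=|y|+1$, and $d(x,y)=0$ otherwise. The Dirac matrix is $D=d+d^*$, with $d^*$ the transpose. For an open set $U\subset G$, $D_U$ is the matrix defined by the same formula with rows and columns indexed by $U$. The Dirac graph of $G$ (respectively $U$) has the elements of $G$ (respectively $U$) as vertices, and two vertices $x,y$ are connected if $D(x,y)\ne0$ (respectively $D_U(x,y)\neq 0$); the degree of $x$ is $d_x=\sum_y|D(x,y)|$ (respectively $\sum_{y\in U}|D_U(x,y)|$).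 -}

module Defs where

open import Algebra.Bundles.Raw using (RawRing)
import Algebra.Definitions.RawMonoid as RawMonoidDefinitions
import Algebra.Definitions.RawSemiring as RawSemiringDefinitions
open import Data.Bool.Base using (if_then_else_)
open import Data.Fin.Base as Fin using (Fin; zero; suc; toℕ)
import Data.Fin.Properties as Fin
open import Data.Fin.Permutation using (Permutation′; _⟨$⟩ʳ_)
open import Data.Fin.Subset using (Subset; Nonempty; _∈_; _⊆_; ∣_∣)
open import Data.Fin.Subset.Properties using (_∈?_; _⊆?_)
open import Data.Integer.Base as ℤ using (ℤ)
open import Data.List.Base using (List; []; _∷_; _++_; length; filter; lookup; allFin)
import Data.List.Membership.Propositional as List
open import Data.List.Relation.Unary.Unique.Propositional using (Unique)
open import Data.Nat.Base as ℕ using (ℕ; zero; suc)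
import Data.Nat.Properties as ℕ
open import Data.Product.Base using (∃-syntax; _×_; _,_)
open import Data.Rational.Base as ℚ using (ℚ; 0ℚ; 1ℚ; ½)
import Data.Rational.Properties as ℚ
open import Data.Rational.Solver using (module +-*-Solver)
open import Data.Vec.Functional using (Vector; removeAt)
open import Function.Bundles using (_⇔_)
open import Function.Definitions using (Injective)
open import Level using (0ℓ; _⊔_)
open import Relation.Binary.PropositionalEquality
open import Relation.Nullary.Decidable using (does; ¬?; _×-dec_)

------------------------------------------------------------------------
-- Real numbers: Cauchy sequences of rationals, with equality and order
-- defined on the sequences (a setoid, not a quotient)

IsCauchy : (ℕ → ℚ) → Set
IsCauchy s = ∀ ε → 0ℚ ℚ.< ε →
  ∃[ N ] ∀ m n → N ℕ.≤ m → N ℕ.≤ n → ℚ.∣ s m ℚ.- s n ∣ ℚ.≤ ε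

record ℝ : Set where
  constructor mkℝ
  field
    seq    : ℕ → ℚ
    cauchy : IsCauchy seq

open ℝ public

infix 4 _≃_ _≤ᴿ_

_≃_ : ℝ → ℝ → Set
x ≃ y = ∀ ε → 0ℚ ℚ.< ε →
  ∃[ N ] ∀ n → N ℕ.≤ n → ℚ.∣ seq x n ℚ.- seq y n ∣ ℚ.≤ ε

_≤ᴿ_ : ℝ → ℝ → Set
x ≤ᴿ y = ∀ ε → 0ℚ ℚ.< ε →
  ∃[ N ] ∀ n → N ℕ.≤ n → seq x n ℚ.≤ seq y n ℚ.+ ε

private
  halve : ∀ {ε} → 0ℚ ℚ.< ε → 0ℚ ℚ.< ½ ℚ.* ε
  halve {ε} 0<ε = ℚ.positive⁻¹ _ {{ℚ.pos*pos⇒pos ½ ε {{ℚ.positive 0<ε}}}}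

  halves : ∀ ε → ½ ℚ.* ε ℚ.+ ½ ℚ.* ε ≡ ε
  halves ε = trans (sym (ℚ.*-distribʳ-+ ε ½ ½)) (ℚ.*-identityˡ ε)

  const-cauchy : ∀ q → IsCauchy (λ _ → q)
  const-cauchy q ε 0<ε = 0 , λ _ _ _ _ →
    subst (ℚ._≤ ε) (sym (cong ℚ.∣_∣ (ℚ.+-inverseʳ q))) (ℚ.<⇒≤ 0<ε)

  +-cauchy : ∀ s t → IsCauchy s → IsCauchy t → IsCauchy (λ n → s n ℚ.+ t n)
  +-cauchy s t cs ct ε 0<ε =
    let (M , p) = cs (½ ℚ.* ε) (halve 0<ε)
        (N , q) = ct (½ ℚ.* ε) (halve 0<ε)
    in M ℕ.⊔ N , λ m n M⊔N≤m M⊔N≤n → begin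
      ℚ.∣ s m ℚ.+ t m ℚ.- (s n ℚ.+ t n) ∣
        ≡⟨ cong ℚ.∣_∣ (regroup (s m) (t m) (s n) (t n)) ⟩
      ℚ.∣ (s m ℚ.- s n) ℚ.+ (t m ℚ.- t n) ∣
        ≤⟨ ℚ.∣p+q∣≤∣p∣+∣q∣ (s m ℚ.- s n) (t m ℚ.- t n) ⟩
      ℚ.∣ s m ℚ.- s n ∣ ℚ.+ ℚ.∣ t m ℚ.- t n ∣
        ≤⟨ ℚ.+-mono-≤
             (p m n (ℕ.m⊔n≤o⇒m≤o M N M⊔N≤m) (ℕ.m⊔n≤o⇒m≤o M N M⊔N≤n))
             (q m n (ℕ.m⊔n≤o⇒n≤o M N M⊔N≤m) (ℕ.m⊔n≤o⇒n≤o M N M⊔N≤n)) ⟩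
      ½ ℚ.* ε ℚ.+ ½ ℚ.* ε
        ≡⟨ halves ε ⟩
      ε ∎
    where
    open ℚ.≤-Reasoning
    open +-*-Solver
    regroup : ∀ a b c d → a ℚ.+ b ℚ.- (c ℚ.+ d) ≡ (a ℚ.- c) ℚ.+ (b ℚ.- d)
    regroup = solve 4 (λ a b c d → a :+ b :- (c :+ d) := (a :- c) :+ (b :- d)) refl

  neg-cauchy : ∀ s → IsCauchy s → IsCauchy (λ n → ℚ.- s n)
  neg-cauchy s cs ε 0<ε = let (N , p) = cs ε 0<ε in
    N , λ m n N≤m N≤n →
      subst (ℚ._≤ ε) (sym (trans (cong ℚ.∣_∣ (swap (s m) (s n)))
                                 (ℚ.∣-p∣≡∣p∣ (s m ℚ.- s n))))
            (p m n N≤m N≤n)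
    where
    open +-*-Solver
    swap : ∀ a b → ℚ.- a ℚ.- (ℚ.- b) ≡ ℚ.- (a ℚ.- b)
    swap = solve 2 (λ a b → (:- a) :- (:- b) := :- (a :- b)) refl

  tail-bounded : ∀ s → IsCauchy s →
    ∃[ B ] (0ℚ ℚ.< B × ∃[ N ] ∀ n → N ℕ.≤ n → ℚ.∣ s n ∣ ℚ.≤ B)
  tail-bounded s cs = let (N , p) = cs 1ℚ (ℚ.positive⁻¹ 1ℚ) in
    1ℚ ℚ.+ ℚ.∣ s N ∣ ,
    ℚ.+-mono-<-≤ (ℚ.positive⁻¹ 1ℚ) (ℚ.0≤∣p∣ (s N)) ,
    N , λ n N≤n → begin
      ℚ.∣ s n ∣
        ≡⟨ cong ℚ.∣_∣ (split (s n) (s N)) ⟩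
      ℚ.∣ (s n ℚ.- s N) ℚ.+ s N ∣
        ≤⟨ ℚ.∣p+q∣≤∣p∣+∣q∣ (s n ℚ.- s N) (s N) ⟩
      ℚ.∣ s n ℚ.- s N ∣ ℚ.+ ℚ.∣ s N ∣
        ≤⟨ ℚ.+-monoˡ-≤ ℚ.∣ s N ∣ (p n N N≤n ℕ.≤-refl) ⟩
      1ℚ ℚ.+ ℚ.∣ s N ∣ ∎
    where
    open ℚ.≤-Reasoning
    open +-*-Solver
    split : ∀ a b → a ≡ (a ℚ.- b) ℚ.+ b
    split = solve 2 (λ a b → a := (a :- b) :+ b) refl

  quotient : ∀ {K ε} → 0ℚ ℚ.< K → 0ℚ ℚ.< ε → ∃[ δ ] (0ℚ ℚ.< δ × K ℚ.* δ ≡ ε)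
  quotient {K} {ε} 0<K 0<ε =
    K⁻¹ ℚ.* ε ,
    ℚ.positive⁻¹ _ {{ℚ.pos*pos⇒pos K⁻¹ {{ℚ.1/pos⇒pos K}} ε {{ℚ.positive 0<ε}}}} ,
    trans (sym (ℚ.*-assoc K K⁻¹ ε))
      (trans (cong (ℚ._* ε) (ℚ.*-inverseʳ K)) (ℚ.*-identityˡ ε))
    where
    instance
      K-positive : ℚ.Positive K
      K-positive = ℚ.positive 0<K
      K-nonZero : ℚ.NonZero K
      K-nonZero = ℚ.pos⇒nonZero K
    K⁻¹ = ℚ.1/ K

  *-cauchy : ∀ s t → IsCauchy s → IsCauchy t → IsCauchy (λ n → s n ℚ.* t n)
  *-cauchy s t cs ct ε 0<ε =
    let (B , 0<B , M₁ , boundS) = tail-bounded s cs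
        (C , 0<C , M₂ , boundT) = tail-bounded t ct
        (δ , 0<δ , Kδ≡ε) = quotient (ℚ.+-mono-< 0<C 0<B) 0<ε
        (N₁ , p) = cs δ 0<δ
        (N₂ , q) = ct δ 0<δ
        instance
          C-nn   = ℚ.nonNegative (ℚ.<⇒≤ 0<C)
          B-nn   = ℚ.nonNegative (ℚ.<⇒≤ 0<B)
        L₁ = M₁ ℕ.⊔ N₁
        L₂ = M₂ ℕ.⊔ N₂
        L  = L₁ ℕ.⊔ L₂
        M₁≤ : ∀ {n} → L ℕ.≤ n → M₁ ℕ.≤ n
        M₁≤ = λ h → ℕ.m⊔n≤o⇒m≤o M₁ N₁ (ℕ.m⊔n≤o⇒m≤o L₁ L₂ h)
        N₁≤ : ∀ {n} → L ℕ.≤ n → N₁ ℕ.≤ n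
        N₁≤ = λ h → ℕ.m⊔n≤o⇒n≤o M₁ N₁ (ℕ.m⊔n≤o⇒m≤o L₁ L₂ h)
        M₂≤ : ∀ {n} → L ℕ.≤ n → M₂ ℕ.≤ n
        M₂≤ = λ h → ℕ.m⊔n≤o⇒m≤o M₂ N₂ (ℕ.m⊔n≤o⇒n≤o L₁ L₂ h)
        N₂≤ : ∀ {n} → L ℕ.≤ n → N₂ ℕ.≤ n
        N₂≤ = λ h → ℕ.m⊔n≤o⇒n≤o M₂ N₂ (ℕ.m⊔n≤o⇒n≤o L₁ L₂ h)
    in L , λ m n L≤m L≤n → begin
      ℚ.∣ s m ℚ.* t m ℚ.- s n ℚ.* t n ∣
        ≡⟨ cong ℚ.∣_∣ (regroup (s m) (t m) (s n) (t n)) ⟩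
      ℚ.∣ t m ℚ.* (s m ℚ.- s n) ℚ.+ s n ℚ.* (t m ℚ.- t n) ∣
        ≤⟨ ℚ.∣p+q∣≤∣p∣+∣q∣ (t m ℚ.* (s m ℚ.- s n)) (s n ℚ.* (t m ℚ.- t n)) ⟩
      ℚ.∣ t m ℚ.* (s m ℚ.- s n) ∣ ℚ.+ ℚ.∣ s n ℚ.* (t m ℚ.- t n) ∣
        ≤⟨ ℚ.+-mono-≤
             (times C (t m) (s m ℚ.- s n) (boundT m (M₂≤ L≤m)) (p m n (N₁≤ L≤m) (N₁≤ L≤n)))
             (times B (s n) (t m ℚ.- t n) (boundS n (M₁≤ L≤n)) (q m n (N₂≤ L≤m) (N₂≤ L≤n))) ⟩
      C ℚ.* δ ℚ.+ B ℚ.* δ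
        ≡⟨ sym (ℚ.*-distribʳ-+ δ C B) ⟩
      (C ℚ.+ B) ℚ.* δ
        ≡⟨ Kδ≡ε ⟩
      ε ∎
    where
    open ℚ.≤-Reasoning
    open +-*-Solver
    regroup : ∀ a b c d → a ℚ.* b ℚ.- c ℚ.* d ≡ b ℚ.* (a ℚ.- c) ℚ.+ c ℚ.* (b ℚ.- d)
    regroup = solve 4 (λ a b c d → a :* b :- c :* d := b :* (a :- c) :+ c :* (b :- d)) refl

    times : ∀ A a b {e} .{{_ : ℚ.NonNegative A}} → ℚ.∣ a ∣ ℚ.≤ A → ℚ.∣ b ∣ ℚ.≤ e →
            ℚ.∣ a ℚ.* b ∣ ℚ.≤ A ℚ.* e
    times A a b {e} a≤ b≤ = begin
      ℚ.∣ a ℚ.* b ∣         ≡⟨ ℚ.∣p*q∣≡∣p∣*∣q∣ a b ⟩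
      ℚ.∣ a ∣ ℚ.* ℚ.∣ b ∣   ≤⟨ ℚ.*-monoʳ-≤-nonNeg ℚ.∣ b ∣ {{ℚ.nonNegative (ℚ.0≤∣p∣ b)}} a≤ ⟩
      A ℚ.* ℚ.∣ b ∣         ≤⟨ ℚ.*-monoˡ-≤-nonNeg A b≤ ⟩
      A ℚ.* e               ∎

fromℚ : ℚ → ℝ
fromℚ q = mkℝ (λ _ → q) (const-cauchy q)

fromℤ : ℤ → ℝ
fromℤ z = fromℚ (z ℚ./ 1)

fromℕ : ℕ → ℝ
fromℕ k = fromℤ (ℤ.+ k)

infixl 6 _+ᴿ_
infixl 7 _*ᴿ_
infix  8 -ᴿ_

_+ᴿ_ _*ᴿ_ : ℝ → ℝ → ℝ
x +ᴿ y = mkℝ (λ n → seq x n ℚ.+ seq y n) (+-cauchy (seq x) (seq y) (cauchy x) (cauchy y))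
x *ᴿ y = mkℝ (λ n → seq x n ℚ.* seq y n) (*-cauchy (seq x) (seq y) (cauchy x) (cauchy y))

-ᴿ_ : ℝ → ℝ
-ᴿ x = mkℝ (λ n → ℚ.- seq x n) (neg-cauchy (seq x) (cauchy x))

ℝ-rawRing : RawRing 0ℓ 0ℓ
ℝ-rawRing = record
  { Carrier = ℝ
  ; _≈_     = _≃_
  ; _+_     = _+ᴿ_
  ; _*_     = _*ᴿ_
  ; -_      = -ᴿ_
  ; 0#      = fromℚ 0ℚ
  ; 1#      = fromℚ 1ℚ
  }

------------------------------------------------------------------------
-- Determinants and eigenvalues

Matrix : ∀ {a} → Set a → ℕ → Set a
Matrix A n = Fin n → Fin n → A

module _ {c ℓ} (R : RawRing c ℓ) where
  open RawRing R
  open RawSemiringDefinitions rawSemiring using (sum; product; _^_)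

  -- Laplace expansion along the first row
  det : ∀ {n} → Matrix Carrier n → Carrier
  det {zero}  A = 1#
  det {suc n} A = sum λ j →
    (- 1#) ^ toℕ j * A zero j * det (λ i → removeAt (A (suc i)) j)

  -- The characteristic polynomial det (t I - A), as a function of t
  charPoly : ∀ {n} → Matrix Carrier n → Carrier → Carrier
  charPoly A t = det λ i j → (if does (i Fin.≟ j) then t else 0#) + - A i j

  -- μ lists the eigenvalues of A with (algebraic) multiplicity
  Eigenvalues : ∀ {n} → Matrix Carrier n → Vector Carrier n → Set (c ⊔ ℓ)
  Eigenvalues A μ = ∀ t → charPoly A t ≈ product (λ i → t + - μ i)

-- μ lists the eigenvalues of the integer matrix A in descending order
DescendingEigenvalues : ∀ {n} → Matrix ℤ n → Vector ℝ n → Set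
DescendingEigenvalues A μ =
  Eigenvalues ℝ-rawRing (λ i j → fromℤ (A i j)) μ ×
  (∀ {i j} → i Fin.≤ j → μ j ≤ᴿ μ i)

------------------------------------------------------------------------
-- Degrees

degree : ∀ {n} → Matrix ℤ n → Fin n → ℕ
degree A x = sum λ y → ℤ.∣ A x y ∣
  where open RawMonoidDefinitions ℕ.+-0-rawMonoid using (sum)

-- δ lists the degrees in descending order
DescendingDegrees : ∀ {n} → Matrix ℤ n → Vector ℕ n → Set
DescendingDegrees {n} A δ =
  (∃[ π ] ∀ i → δ i ≡ degree A (π ⟨$⟩ʳ i)) ×
  (∀ {i j} → i Fin.≤ j → δ j ℕ.≤ δ i)

------------------------------------------------------------------------
-- Simplicial complexes

-- A complex with n simplices, whose vertices are labelled by elements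
-- of Fin m (not every label has to occur).
record SimplicialComplex (m n : ℕ) : Set where
  field
    simplex   : Fin n → Subset m
    injective : Injective _≡_ _≡_ simplex
    nonempty  : ∀ x → Nonempty (simplex x)
    closed    : ∀ x {p} → Nonempty p → p ⊆ simplex x → ∃[ y ] simplex y ≡ p

-- The orderings of different simplices need not be compatible.
record VertexOrdering {m n} (G : SimplicialComplex m n) : Set where
  open SimplicialComplex G
  field
    vertices : Fin n → List (Fin m)
    unique   : ∀ x → Unique (vertices x)
    complete : ∀ x v → v List.∈ vertices x ⇔ v ∈ simplex x

Open : ∀ {m n} → SimplicialComplex m n → Subset n → Set
Open G U = ∀ {x y} → x ∈ U → simplex x ⊆ simplex y → y ∈ U
  where open SimplicialComplex G

module _ {m : ℕ} where

  -- Index of the first occurrence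
  position : Fin m → List (Fin m) → ℕ
  position v []       = 0
  position v (w ∷ ws) = if does (v Fin.≟ w) then 0 else suc (position v ws)

  -- Number of pairs occurring in the first list in the opposite order
  -- to the second
  inversions : List (Fin m) → List (Fin m) → ℕ
  inversions []       bs = 0
  inversions (a ∷ as) bs =
    length (filter (λ a′ → position a′ bs ℕ.<? position a bs) as) ℕ.+ inversions as bs

  -- Sign of the permutation taking as to bs, for two lists of the same
  -- distinct elements
  permutationSign : List (Fin m) → List (Fin m) → ℤ
  permutationSign as bs = ℤ.-1ℤ ℤ.^ inversions as bs

module _ {m n} (G : SimplicialComplex m n) (O : VertexOrdering G) where
  open SimplicialComplex G
  open VertexOrdering O

  -- When y is a facet of x, the filtered list consists of the single
  -- vertex in x ∖ y.
  sign : Fin n → Fin n → ℤ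
  sign x y = permutationSign
    (filter (λ v → ¬? (v ∈? simplex y)) (vertices x) ++ vertices y)
    (vertices x)

  exteriorDerivative : Matrix ℤ n
  exteriorDerivative x y =
    if does ((simplex y ⊆? simplex x) ×-dec (∣ simplex x ∣ ℕ.≟ suc ∣ simplex y ∣))
    then sign x y
    else ℤ.0ℤ

  dirac : Matrix ℤ n
  dirac x y = exteriorDerivative x y ℤ.+ exteriorDerivative y x

  diracOn : (U : Subset n) → Matrix ℤ (length (filter (_∈? U) (allFin n)))
  diracOn U i j = dirac (lookup elements i) (lookup elements j)
    where elements = filter (_∈? U) (allFin n)

{-# OPTIONS --safe #-}

-- The bound holds for every symmetric integer matrix A with absolute row
-- sums d₁ ≥ … ≥ dₙ. If λ₁ ≥ … ≥ λⱼ > d = dⱼ, there are j orthogonal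
-- eigenvectors with these eigenvalues, and some nonzero combination x of them
-- vanishes at the j - 1 indices of largest row sum. Then ⟨x , A x⟩ > d ⟨x , x⟩,
-- while 2 (d ⟨x , x⟩ - ⟨x , A x⟩) is a sum of the nonnegative terms
-- |Aᵢₖ| (xᵢ ± xₖ)² and 2 (d - dᵢ) xᵢ².
--
-- The eigenvectors come from the factored characteristic polynomial alone:
-- the columns of t - A are replaced one at a time by eigenvectors, each
-- replacement cancelling one factor t - λᵢ from the determinant. No division
-- takes place, so an ordered integral domain suffices as scalars. Cauchy reals
-- do not have decidable equality, but the inequality to be proved is stable
-- under double negation, so case distinctions on vanishing are admissible.

module Submission where

open import Defs
open import Algebra.Bundles using (CommutativeRing)
open import Algebra.Bundles.Raw using (RawRing)
import Algebra.Definitions.RawMonoid as RawMonoidDefinitions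
import Algebra.Definitions.RawSemiring as RawSemiringDefinitions
import Algebra.Properties.Ring
import Algebra.Properties.Semiring.Mult.TCOptimised
import Algebra.Properties.Semiring.Sum
import Algebra.Solver.Ring
open import Algebra.Solver.Ring.AlmostCommutativeRing
  using (fromCommutativeRing; _-Raw-AlmostCommutative⟶_)
open import Algebra.Structures using (IsCommutativeRing)
open import Data.Bool.Base using (true; false; if_then_else_)
open import Data.Fin.Base as Fin using (Fin; zero; suc; toℕ; inject; fromℕ<)
open import Data.Fin.Permutation using (_⟨$⟩ʳ_; _⟨$⟩ˡ_; inverseʳ)
import Data.Fin.Properties as Fin
open import Data.Fin.Subset using (Subset)
open import Data.Integer.Base as ℤ using (ℤ; -[1+_]; _⊖_; _◃_)
import Data.Integer.Properties as ℤ
open import Data.List.Base using (List; []; _∷_; _++_; map; tabulate; length; take; drop)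
import Data.List.Properties as List
open import Data.List.Relation.Binary.Pointwise as Pointwise using (Pointwise; []; _∷_)
open import Data.List.Relation.Unary.All as All using (All; []; _∷_)
open import Data.Maybe.Base as Maybe using (Maybe)
open import Data.Nat.Base as ℕ using (ℕ; zero; suc)
import Data.Nat.Coprimality as Coprime
import Data.Nat.Properties as ℕ
open import Data.Product.Base using (_×_; _,_; ∃-syntax; proj₁; proj₂)
open import Data.Rational.Base as ℚ using (ℚ; 0ℚ; 1ℚ; ½)
import Data.Rational.Properties as ℚ
open import Data.Rational.Solver using (module +-*-Solver)
open import Data.Sign.Base as Sign using (Sign)
open import Data.Sum.Base using (_⊎_; inj₁; inj₂; [_,_]′)
open import Data.Vec.Functional as Vector using (Vector; tail; removeAt)
open import Function.Base using (_∘_; id)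
open import Level using (0ℓ; _⊔_)
open import Relation.Binary.Consequences using (dec⇒weaklyDec)
open import Relation.Binary.PropositionalEquality as ≡ using (_≡_)
import Relation.Binary.Reasoning.Setoid
open import Relation.Nullary.Decidable using (does; yes; no; from-no; ¬¬-excluded-middle)
open import Relation.Nullary.Negation using (¬_; contradiction)
open import Relation.Unary using (Pred)

-- The factored characteristic polynomial records algebraic multiplicities, while the dimension
-- count needs equally many eigenvectors; for a repeated value `a`, singularity of `a - A` by itself
-- yields only one. Hence the mixed determinants, with columns `(t - A) e` for vectors `e` not yet
-- treated and constant columns `v` for the eigenvectors found. A dependence at `t = a` produces `w`
-- with `(a - A) w` in the span of the `v`. Once `w` is made orthogonal to them, symmetry puts
-- `(a - A) w` into their orthogonal complement too, so it vanishes. Then `(t - A) w = (t - a) w`,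
-- and putting `w` in place of a column extracts the factor `t - a`. Pointwise this factor cancels
-- only away from `t = a`; therefore determinants are treated as polynomial functions, which are
-- determined by their values at `a + 1`, `a + 2`, and so on. The remaining product still vanishes
-- at the next eigenvalue, equal or not, and it also shows that `w` is nonzero.

-- Ring solver with integer coefficients over a commutative ring

module IntegerSolver {c ℓ} (R : CommutativeRing c ℓ) where
  open CommutativeRing R
  open Algebra.Properties.Ring ring
  open Algebra.Properties.Semiring.Mult.TCOptimised semiring renaming (_×_ to infixl 8 _×ᴿ_)
  open Relation.Binary.Reasoning.Setoid setoid

  private
    ⟦_⟧ᶻ : ℤ → Carrier
    ⟦ ℤ.+ n ⟧ᶻ    = n ×ᴿ 1#
    ⟦ -[1+ n ] ⟧ᶻ = - (suc n ×ᴿ 1#)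

    ⊖-homo : ∀ m n → ⟦ m ⊖ n ⟧ᶻ ≈ m ×ᴿ 1# - n ×ᴿ 1#
    ⊖-homo zero    zero    = sym (-‿inverseʳ 0#)
    ⊖-homo zero    (suc n) = sym (+-identityˡ _)
    ⊖-homo (suc m) zero    = sym (trans (+-congˡ -0#≈0#) (+-identityʳ _))
    ⊖-homo (suc m) (suc n) = begin
      ⟦ suc m ⊖ suc n ⟧ᶻ            ≡⟨ ≡.cong ⟦_⟧ᶻ (ℤ.[1+m]⊖[1+n]≡m⊖n m n) ⟩
      ⟦ m ⊖ n ⟧ᶻ                    ≈⟨ ⊖-homo m n ⟩
      M - N                         ≈⟨ +-congʳ (+-identityʳ M) ⟨
      M + 0# - N                    ≈⟨ +-congʳ (+-congˡ (-‿inverseʳ 1#)) ⟨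
      M + (1# - 1#) - N             ≈⟨ +-congʳ (+-assoc M 1# (- 1#)) ⟨
      M + 1# - 1# - N               ≈⟨ +-congʳ (+-congʳ (+-comm M 1#)) ⟩
      1# + M - 1# - N               ≈⟨ +-assoc (1# + M) (- 1#) (- N) ⟩
      1# + M + (- 1# - N)           ≈⟨ +-congˡ (-‿+-comm 1# N) ⟩
      1# + M - (1# + N)             ≈⟨ +-cong (1+× m 1#) (-‿cong (1+× n 1#)) ⟨
      suc m ×ᴿ 1# - suc n ×ᴿ 1#       ∎
      where
      M = m ×ᴿ 1#
      N = n ×ᴿ 1#

    +-homoᶻ : ∀ i j → ⟦ i ℤ.+ j ⟧ᶻ ≈ ⟦ i ⟧ᶻ + ⟦ j ⟧ᶻ
    +-homoᶻ (ℤ.+ m)  (ℤ.+ n)  = ×-homo-+ 1# m n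
    +-homoᶻ (ℤ.+ m)  -[1+ n ] = ⊖-homo m (suc n)
    +-homoᶻ -[1+ m ] (ℤ.+ n)  = trans (⊖-homo n (suc m)) (+-comm _ _)
    +-homoᶻ -[1+ m ] -[1+ n ] = begin
      - (suc (suc (m ℕ.+ n)) ×ᴿ 1#)        ≡⟨ ≡.cong (λ k → - (suc k ×ᴿ 1#)) (ℕ.+-suc m n) ⟨
      - ((suc m ℕ.+ suc n) ×ᴿ 1#)          ≈⟨ -‿cong (×-homo-+ 1# (suc m) (suc n)) ⟩
      - (suc m ×ᴿ 1# + suc n ×ᴿ 1#)         ≈⟨ -‿+-comm _ _ ⟨
      - (suc m ×ᴿ 1#) - suc n ×ᴿ 1#         ∎

    -homoᶻ : ∀ i → ⟦ ℤ.- i ⟧ᶻ ≈ - ⟦ i ⟧ᶻ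
    -homoᶻ (ℤ.+ zero)  = sym -0#≈0#
    -homoᶻ (ℤ.+ suc n) = refl
    -homoᶻ -[1+ n ]    = sym (-‿involutive _)

    *-homoᶻ : ∀ i j → ⟦ i ℤ.* j ⟧ᶻ ≈ ⟦ i ⟧ᶻ * ⟦ j ⟧ᶻ
    *-homoᶻ (ℤ.+ m) (ℤ.+ n) = begin
      ⟦ Sign.+ ◃ (m ℕ.* n) ⟧ᶻ   ≡⟨ ≡.cong ⟦_⟧ᶻ (ℤ.+◃n≡+n (m ℕ.* n)) ⟩
      (m ℕ.* n) ×ᴿ 1#            ≈⟨ ×1-homo-* m n ⟩
      m ×ᴿ 1# * n ×ᴿ 1#           ∎
    *-homoᶻ (ℤ.+ m) -[1+ n ] = begin
      ⟦ Sign.- ◃ (m ℕ.* suc n) ⟧ᶻ    ≡⟨ ≡.cong ⟦_⟧ᶻ (ℤ.-◃n≡-n (m ℕ.* suc n)) ⟩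
      ⟦ ℤ.- (ℤ.+ (m ℕ.* suc n)) ⟧ᶻ   ≈⟨ -homoᶻ (ℤ.+ (m ℕ.* suc n)) ⟩
      - ((m ℕ.* suc n) ×ᴿ 1#)         ≈⟨ -‿cong (×1-homo-* m (suc n)) ⟩
      - (m ×ᴿ 1# * suc n ×ᴿ 1#)        ≈⟨ -‿distribʳ-* _ _ ⟩
      m ×ᴿ 1# * - (suc n ×ᴿ 1#)        ∎
    *-homoᶻ -[1+ m ] (ℤ.+ n) = begin
      ⟦ Sign.- ◃ (suc m ℕ.* n) ⟧ᶻ    ≡⟨ ≡.cong ⟦_⟧ᶻ (ℤ.-◃n≡-n (suc m ℕ.* n)) ⟩
      ⟦ ℤ.- (ℤ.+ (suc m ℕ.* n)) ⟧ᶻ   ≈⟨ -homoᶻ (ℤ.+ (suc m ℕ.* n)) ⟩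
      - ((suc m ℕ.* n) ×ᴿ 1#)         ≈⟨ -‿cong (×1-homo-* (suc m) n) ⟩
      - (suc m ×ᴿ 1# * n ×ᴿ 1#)        ≈⟨ -‿distribˡ-* _ _ ⟩
      - (suc m ×ᴿ 1#) * n ×ᴿ 1#        ∎
    *-homoᶻ -[1+ m ] -[1+ n ] = begin
      (suc m ℕ.* suc n) ×ᴿ 1#               ≈⟨ ×1-homo-* (suc m) (suc n) ⟩
      suc m ×ᴿ 1# * suc n ×ᴿ 1#              ≈⟨ -‿involutive _ ⟨
      - - (suc m ×ᴿ 1# * suc n ×ᴿ 1#)        ≈⟨ -‿cong (-‿distribʳ-* _ _) ⟩
      - (suc m ×ᴿ 1# * - (suc n ×ᴿ 1#))      ≈⟨ -‿distribˡ-* _ _ ⟩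
      - (suc m ×ᴿ 1#) * - (suc n ×ᴿ 1#)      ∎

    morphism : ℤ.+-*-rawRing -Raw-AlmostCommutative⟶ fromCommutativeRing R
    morphism = record
      { ⟦_⟧    = ⟦_⟧ᶻ
      ; +-homo = +-homoᶻ
      ; *-homo = *-homoᶻ
      ; -‿homo = -homoᶻ
      ; 0-homo = refl
      ; 1-homo = refl
      }

    -- Equality in `R` need not be decidable, but equality of integer coefficients is; this lets the
    -- solver recognise terms that cancel.
    _≟ᶻ_ : ∀ i j → Maybe (⟦ i ⟧ᶻ ≈ ⟦ j ⟧ᶻ)
    i ≟ᶻ j = Maybe.map (λ i≡j → reflexive (≡.cong ⟦_⟧ᶻ i≡j)) (dec⇒weaklyDec ℤ._≟_ i j)

  open Algebra.Solver.Ring ℤ.+-*-rawRing (fromCommutativeRing R) morphism _≟ᶻ_ public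
    using (solve; _:=_; _:+_; _:*_; _:-_; :-_; con)

-- Determinants as alternating functions of a list of columns

module Determinants {c ℓ} (R : CommutativeRing c ℓ) where
  open CommutativeRing R hiding (zero)
  open IntegerSolver R
  open Algebra.Properties.Ring ring
  open Algebra.Properties.Semiring.Sum semiring using (sum; sum-cong-≋; *-distribˡ-sum)
  open RawSemiringDefinitions (RawRing.rawSemiring rawRing) using (_^_)
  open Relation.Binary.Reasoning.Setoid setoid

  private
    variable
      m n : ℕ

  infix 4 _≋_
  _≋_ : Vector Carrier m → Vector Carrier m → Set ℓ
  x ≋ y = ∀ i → x i ≈ y i

  infix 4 _≋*_
  _≋*_ : List (Vector Carrier m) → List (Vector Carrier m) → Set _
  _≋*_ = Pointwise _≋_

  ≋*-refl : {xs : List (Vector Carrier m)} → xs ≋* xs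
  ≋*-refl = Pointwise.refl (λ i → refl)

  combine : Carrier → Vector Carrier m → Carrier → Vector Carrier m → Vector Carrier m
  combine a x b y i = a * x i + b * y i

  -- Laplace expansion along the first row, with the list of the remaining
  -- columns passed to a function in place of the minor.
  expand : List (Vector Carrier (suc m)) → (List (Vector Carrier (suc m)) → Carrier) → Carrier
  expand []       f = 0#
  expand (x ∷ xs) f = x zero * f xs - expand xs (f ∘ (x ∷_))

  -- 0# unless there are m columns
  detCols : ∀ m → List (Vector Carrier m) → Carrier
  detCols zero    []      = 1#
  detCols zero    (_ ∷ _) = 0#
  detCols (suc m) xs      = expand xs (detCols m ∘ map tail)

  -- Antisymmetry under swapping neighbours passes through `expand` over any commutative ring.
  -- Vanishing on repeated columns is recovered in `alternating-repeat`, where 2 can be cancelled.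
  record Alternating (f : List (Vector Carrier m) → Carrier) : Set (c ⊔ ℓ) where
    field
      cong   : ∀ {xs ys} → xs ≋* ys → f xs ≈ f ys
      linear : ∀ xs a x b y zs →
        f (xs ++ combine a x b y ∷ zs) ≈ a * f (xs ++ x ∷ zs) + b * f (xs ++ y ∷ zs)
      swap   : ∀ xs x y zs → f (xs ++ x ∷ y ∷ zs) ≈ - f (xs ++ y ∷ x ∷ zs)

  open Alternating

  module _ {f : List (Vector Carrier m) → Carrier} (alt : Alternating f) where

    alternating-∷ : ∀ x → Alternating (f ∘ (x ∷_))
    alternating-∷ x = record
      { cong   = λ p → cong alt ((λ _ → refl) ∷ p)
      ; linear = λ xs → linear alt (x ∷ xs)
      ; swap   = λ xs → swap alt (x ∷ xs)
      }

    alternating-tail : Alternating (f ∘ map tail)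
    alternating-tail = record
      { cong   = λ p → cong alt (Pointwise.map⁺ _ _ (Pointwise.map (λ q i → q (suc i)) p))
      ; linear = λ xs a x b y zs → begin
          f (map tail (xs ++ combine a x b y ∷ zs))
            ≡⟨ ≡.cong f (List.map-++ tail xs (combine a x b y ∷ zs)) ⟩
          f (map tail xs ++ combine a (tail x) b (tail y) ∷ map tail zs)
            ≈⟨ linear alt (map tail xs) a (tail x) b (tail y) (map tail zs) ⟩
          a * f (map tail xs ++ tail x ∷ map tail zs) + b * f (map tail xs ++ tail y ∷ map tail zs)
            ≡⟨ ≡.cong₂ (λ u v → a * f u + b * f v) (List.map-++ tail xs (x ∷ zs)) (List.map-++ tail xs (y ∷ zs)) ⟨
          a * f (map tail (xs ++ x ∷ zs)) + b * f (map tail (xs ++ y ∷ zs)) ∎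
      ; swap   = λ xs x y zs → begin
          f (map tail (xs ++ x ∷ y ∷ zs))
            ≡⟨ ≡.cong f (List.map-++ tail xs (x ∷ y ∷ zs)) ⟩
          f (map tail xs ++ tail x ∷ tail y ∷ map tail zs)
            ≈⟨ swap alt (map tail xs) (tail x) (tail y) (map tail zs) ⟩
          - f (map tail xs ++ tail y ∷ tail x ∷ map tail zs)
            ≡⟨ ≡.cong (λ u → - f u) (List.map-++ tail xs (y ∷ x ∷ zs)) ⟨
          - f (map tail (xs ++ y ∷ x ∷ zs)) ∎
      }

  expand-cong : ∀ {f g : List (Vector Carrier (suc m)) → Carrier} →
    (∀ {xs ys} → xs ≋* ys → f xs ≈ g ys) →
    ∀ {xs ys} → xs ≋* ys → expand xs f ≈ expand ys g
  expand-cong f≈g []       = refl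
  expand-cong f≈g (p ∷ ps) =
    +-cong (*-cong (p zero) (f≈g ps)) (-‿cong (expand-cong (λ q → f≈g (p ∷ q)) ps))

  expand-congʳ : ∀ {f g : List (Vector Carrier (suc m)) → Carrier} →
    (∀ xs → f xs ≈ g xs) → ∀ xs → expand xs f ≈ expand xs g
  expand-congʳ f≈g []       = refl
  expand-congʳ f≈g (x ∷ xs) =
    +-cong (*-congˡ (f≈g xs)) (-‿cong (expand-congʳ (λ ys → f≈g (x ∷ ys)) xs))

  expand-linear : ∀ a (f : List (Vector Carrier (suc m)) → Carrier) b g xs →
    expand xs (λ ys → a * f ys + b * g ys) ≈ a * expand xs f + b * expand xs g
  expand-linear a f b g []       = sym (trans (+-cong (zeroʳ a) (zeroʳ b)) (+-identityˡ 0#))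
  expand-linear a f b g (x ∷ xs) = trans
    (+-congˡ (-‿cong (expand-linear a (f ∘ (x ∷_)) b (g ∘ (x ∷_)) xs)))
    (solve 7 (λ a b x f g u v →
        x :* (a :* f :+ b :* g) :- (a :* u :+ b :* v) :=
        a :* (x :* f :- u) :+ b :* (x :* g :- v))
      refl a b (x zero) (f xs) (g xs) (expand xs (f ∘ (x ∷_))) (expand xs (g ∘ (x ∷_))))

  expand-neg : ∀ (f : List (Vector Carrier (suc m)) → Carrier) xs →
    expand xs (λ ys → - f ys) ≈ - expand xs f
  expand-neg f []       = sym -0#≈0#
  expand-neg f (x ∷ xs) = trans
    (+-congˡ (-‿cong (expand-neg (f ∘ (x ∷_)) xs)))
    (solve 3 (λ x f u → x :* (:- f) :- (:- u) := :- (x :* f :- u)) refl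
      (x zero) (f xs) (expand xs (f ∘ (x ∷_))))

  expand-alternating : ∀ {f : List (Vector Carrier (suc m)) → Carrier} → Alternating f →
    Alternating (λ xs → expand xs f)
  expand-alternating alt = record
    { cong = expand-cong (cong alt) ; linear = lin alt ; swap = swp alt }
    where
    -- `f` is quantified anew, because moving past a column `w` replaces it by `f ∘ (w ∷_)`.
    lin : ∀ {f : List (Vector Carrier (suc _)) → Carrier} → Alternating f → ∀ xs a x b y zs →
      expand (xs ++ combine a x b y ∷ zs) f ≈
      a * expand (xs ++ x ∷ zs) f + b * expand (xs ++ y ∷ zs) f
    lin {f} alt [] a x b y zs = trans
      (+-congˡ (-‿cong (trans (expand-congʳ (λ ys → linear alt [] a x b y ys) zs)
                              (expand-linear a (f ∘ (x ∷_)) b (f ∘ (y ∷_)) zs))))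
      (solve 7 (λ a b x y f u v →
          (a :* x :+ b :* y) :* f :- (a :* u :+ b :* v) :=
          a :* (x :* f :- u) :+ b :* (y :* f :- v))
        refl a b (x zero) (y zero) (f zs) (expand zs (f ∘ (x ∷_))) (expand zs (f ∘ (y ∷_))))
    lin {f} alt (w ∷ xs) a x b y zs = trans
      (+-cong (*-congˡ (linear alt xs a x b y zs))
              (-‿cong (lin (alternating-∷ alt w) xs a x b y zs)))
      (solve 7 (λ a b w f g u v →
          w :* (a :* f :+ b :* g) :- (a :* u :+ b :* v) :=
          a :* (w :* f :- u) :+ b :* (w :* g :- v))
        refl a b (w zero) (f (xs ++ x ∷ zs)) (f (xs ++ y ∷ zs))
          (expand (xs ++ x ∷ zs) (f ∘ (w ∷_))) (expand (xs ++ y ∷ zs) (f ∘ (w ∷_))))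

    swp : ∀ {f : List (Vector Carrier (suc _)) → Carrier} → Alternating f → ∀ xs x y zs →
      expand (xs ++ x ∷ y ∷ zs) f ≈ - expand (xs ++ y ∷ x ∷ zs) f
    -- The two leading terms of the expansion trade places; only the terms that keep both `x` and
    -- `y` in the minor need antisymmetry of `f`.
    swp {f} alt [] x y zs = trans
      (+-congˡ (-‿cong (+-congˡ (-‿cong
        (trans (expand-congʳ (swap alt [] x y) zs) (expand-neg (λ ys → f (y ∷ x ∷ ys)) zs))))))
      (solve 5 (λ x y f g u →
          x :* f :- (y :* g :- (:- u)) := :- (y :* g :- (x :* f :- u)))
        refl (x zero) (y zero) (f (y ∷ zs)) (f (x ∷ zs)) (expand zs (λ ys → f (y ∷ x ∷ ys))))
    swp {f} alt (w ∷ xs) x y zs = trans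
      (+-cong (*-congˡ (swap alt xs x y zs)) (-‿cong (swp (alternating-∷ alt w) xs x y zs)))
      (solve 3 (λ w f u → w :* (:- f) :- (:- u) := :- (w :* f :- u)) refl
        (w zero) (f (xs ++ y ∷ x ∷ zs)) (expand (xs ++ y ∷ x ∷ zs) (f ∘ (w ∷_))))

  detCols-alternating : ∀ m → Alternating (detCols m)
  detCols-alternating zero = record
    { cong   = λ { [] → refl ; (_ ∷ _) → refl }
    ; linear = λ { [] a x b y zs → sym (trans (+-cong (zeroʳ a) (zeroʳ b)) (+-identityˡ 0#))
                 ; (_ ∷ _) a x b y zs → sym (trans (+-cong (zeroʳ a) (zeroʳ b)) (+-identityˡ 0#)) }
    ; swap   = λ { [] x y zs → sym -0#≈0# ; (_ ∷ _) x y zs → sym -0#≈0# }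
    }
  detCols-alternating (suc m) = expand-alternating (alternating-tail (detCols-alternating m))

  expand-zero : ∀ {f : List (Vector Carrier (suc m)) → Carrier} xs →
    (∀ ys → suc (length ys) ≡ length xs → f ys ≈ 0#) → expand xs f ≈ 0#
  expand-zero         []       f≈0 = refl
  expand-zero {f = f} (x ∷ xs) f≈0 = begin
    x zero * f xs - expand xs (f ∘ (x ∷_))
      ≈⟨ +-cong (*-congˡ (f≈0 xs ≡.refl))
                (-‿cong (expand-zero xs λ ys eq → f≈0 (x ∷ ys) (≡.cong suc eq))) ⟩
    x zero * 0# - 0#
      ≈⟨ +-cong (zeroʳ (x zero)) -0#≈0# ⟩
    0# + 0#
      ≈⟨ +-identityˡ 0# ⟩
    0# ∎

  -- Each expansion step removes one row and one column, so a surplus column survives down to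
  -- `detCols zero (_ ∷ _)`, which is zero by definition. Together with `det≈0⇒dependent` this makes
  -- more than `m` vectors of length `m` dependent.
  detCols-wide : ∀ m xs → m ℕ.< length xs → detCols m xs ≈ 0#
  detCols-wide zero    (_ ∷ _) _  = refl
  detCols-wide (suc m) xs      m< = expand-zero xs λ ys eq →
    detCols-wide m (map tail ys)
      (≡.subst (m ℕ.<_) (≡.sym (List.length-map tail ys))
        (ℕ.s≤s⁻¹ (≡.subst (suc (suc m) ℕ.≤_) (≡.sym eq) m<)))

  -- The nested subtractions of `expand` accumulate to the explicit signs of the indexed Laplace
  -- expansion.
  expand-tabulate : ∀ (x : Fin (suc n) → Vector Carrier (suc m)) f →
    expand (tabulate x) f ≈
    sum (λ j → (- 1#) ^ toℕ j * x j zero * f (tabulate (removeAt x j)))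
  expand-tabulate {n = zero} x f =
    +-cong (*-congʳ (sym (*-identityˡ (x zero zero)))) -0#≈0#
  expand-tabulate {n = suc n} x f = +-cong
    (*-congʳ (sym (*-identityˡ (x zero zero))))
    (begin
      - expand (tabulate (x ∘ suc)) (f ∘ (x zero ∷_))
        ≈⟨ -‿cong (expand-tabulate (x ∘ suc) (f ∘ (x zero ∷_))) ⟩
      - sum terms
        ≈⟨ -1*x≈-x (sum terms) ⟨
      - 1# * sum terms
        ≈⟨ *-distribˡ-sum (- 1#) terms ⟩
      sum (λ j → - 1# * terms j)
        ≈⟨ sum-cong-≋ {suc n} regroup ⟩
      sum (λ j → (- 1#) ^ suc (toℕ j) * x (suc j) zero * f (tabulate (removeAt x (suc j)))) ∎)
    where
    terms : Fin (suc n) → Carrier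
    terms j = (- 1#) ^ toℕ j * x (suc j) zero * f (tabulate (removeAt x (suc j)))
    regroup : ∀ j → - 1# * terms j ≈
              (- 1#) ^ suc (toℕ j) * x (suc j) zero * f (tabulate (removeAt x (suc j)))
    regroup j = trans (sym (*-assoc _ _ _)) (*-congʳ (sym (*-assoc _ _ _)))

  det-detCols : ∀ (A : Matrix Carrier m) → det rawRing A ≈ detCols m (tabulate λ j i → A i j)
  det-detCols {zero}  A = refl
  det-detCols {suc m} A = sym (begin
    expand (tabulate λ j i → A i j) (detCols m ∘ map tail)
      ≈⟨ expand-tabulate (λ j i → A i j) (detCols m ∘ map tail) ⟩
    sum (λ j → (- 1#) ^ toℕ j * A zero j * detCols m (map tail (tabulate (removeAt (λ j i → A i j) j))))
      ≈⟨ sum-cong-≋ {suc m} minors ⟩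
    sum (λ j → (- 1#) ^ toℕ j * A zero j * det rawRing (λ i → removeAt (A (suc i)) j)) ∎)
    where
    minors : ∀ j →
      (- 1#) ^ toℕ j * A zero j * detCols m (map tail (tabulate (removeAt (λ j i → A i j) j))) ≈
      (- 1#) ^ toℕ j * A zero j * det rawRing (λ i → removeAt (A (suc i)) j)
    minors j = *-congˡ {(- 1#) ^ toℕ j * A zero j} (trans
      (reflexive (≡.cong (detCols m) (List.map-tabulate (removeAt (λ j i → A i j) j) tail)))
      (sym (det-detCols (λ i → removeAt (A (suc i)) j))))

-- Ordered integral domains

-- The axioms are chosen to hold for Cauchy reals without deciding any sign: the order is not
-- assumed total, and `integral` cancels a factor known to be nonzero instead of asserting a
-- disjunction.
record OrderedDomain {c ℓ} (R : RawRing c ℓ) p : Set (c ⊔ ℓ ⊔ Level.suc p) where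
  private module Raw = RawRing R
  field
    isCommutativeRing : IsCommutativeRing Raw._≈_ Raw._+_ Raw._*_ Raw.-_ Raw.0# Raw.1#
  commutativeRing : CommutativeRing c ℓ
  commutativeRing = record { isCommutativeRing = isCommutativeRing }
  open CommutativeRing commutativeRing public hiding (zero; rawRing; isCommutativeRing)
  field
    NonNeg         : Pred Carrier p
    nonNeg-resp    : ∀ {x y} → x ≈ y → NonNeg x → NonNeg y
    nonNeg-+       : ∀ {x y} → NonNeg x → NonNeg y → NonNeg (x + y)
    nonNeg-*       : ∀ {x y} → NonNeg x → NonNeg y → NonNeg (x * y)
    nonNeg-square  : ∀ x → NonNeg (x * x)
    nonNeg-antisym : ∀ {x y} → NonNeg x → NonNeg y → x + y ≈ 0# → x ≈ 0#
    integral       : ∀ {x y} → x * y ≈ 0# → ¬ x ≈ 0# → y ≈ 0#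
    1≉0            : ¬ 1# ≈ 0#

-- Linear dependence and fraction-free elimination

module LinearDependence {c ℓ p} {R : RawRing c ℓ} (D : OrderedDomain R p) where
  open OrderedDomain D
  open IntegerSolver commutativeRing
  open Determinants commutativeRing
  open Alternating
  open Algebra.Properties.Ring ring
  open RawSemiringDefinitions (RawRing.rawSemiring R) using (_^_)
  open Relation.Binary.Reasoning.Setoid setoid

  private
    variable
      m n : ℕ
      x y : Vector Carrier m
      xs ys : List (Vector Carrier m)

  *-nonzero : ∀ {a b} → ¬ a ≈ 0# → ¬ b ≈ 0# → ¬ a * b ≈ 0#
  *-nonzero a≉0 b≉0 ab≈0 = b≉0 (integral ab≈0 a≉0)

  nonNeg-1 : NonNeg 1#
  nonNeg-1 = nonNeg-resp (*-identityˡ 1#) (nonNeg-square 1#)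

  2≉0 : ¬ 1# + 1# ≈ 0#
  2≉0 2≈0 = 1≉0 (nonNeg-antisym nonNeg-1 nonNeg-1 2≈0)

  x≈-x⇒x≈0 : ∀ {x} → x ≈ - x → x ≈ 0#
  x≈-x⇒x≈0 {x} eq = integral
    (trans (solve 1 (λ x → (con (ℤ.+ 1) :+ con (ℤ.+ 1)) :* x := x :+ x) refl x)
           (trans (+-congˡ eq) (-‿inverseʳ x)))
    2≉0

  0ᵛ : Vector Carrier m
  0ᵛ _ = 0#

  infixr 8 _·_
  _·_ : Carrier → Vector Carrier m → Vector Carrier m
  (a · x) i = a * x i

  alternating-zero : ∀ {f : List (Vector Carrier m) → Carrier} → Alternating f →
    ∀ x xs → x ≋ 0ᵛ → f (x ∷ xs) ≈ 0#
  alternating-zero {f = f} alt x xs x≋0 = begin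
    f (x ∷ xs)                          ≈⟨ cong alt ((λ i → trans (x≋0 i) (sym (0+0 (x i)))) ∷ ≋*-refl) ⟩
    f (combine 0# x 0# x ∷ xs)          ≈⟨ linear alt [] 0# x 0# x xs ⟩
    0# * f (x ∷ xs) + 0# * f (x ∷ xs)   ≈⟨ 0+0 (f (x ∷ xs)) ⟩
    0#                                  ∎
    where
    0+0 : ∀ a → 0# * a + 0# * a ≈ 0#
    0+0 a = trans (+-cong (zeroˡ a) (zeroˡ a)) (+-identityˡ 0#)

  alternating-move : ∀ {f : List (Vector Carrier m) → Carrier} → Alternating f →
    ∀ x xs ys → f (x ∷ xs ++ ys) ≈ (- 1#) ^ length xs * f (xs ++ x ∷ ys)
  alternating-move alt x []       ys = sym (*-identityˡ _)
  alternating-move {f = f} alt x (z ∷ xs) ys = begin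
    f (x ∷ z ∷ xs ++ ys)
      ≈⟨ swap alt [] x z (xs ++ ys) ⟩
    - f (z ∷ x ∷ xs ++ ys)
      ≈⟨ -‿cong (alternating-move (alternating-∷ alt z) x xs ys) ⟩
    - ((- 1#) ^ length xs * f (z ∷ xs ++ x ∷ ys))
      ≈⟨ solve 2 (λ s t → :- (s :* t) := :- con (ℤ.+ 1) :* s :* t) refl _ _ ⟩
    - 1# * (- 1#) ^ length xs * f (z ∷ xs ++ x ∷ ys)  ∎

  sign-nonzero : ∀ k → ¬ (- 1#) ^ k ≈ 0#
  sign-nonzero zero    = 1≉0
  sign-nonzero (suc k) = *-nonzero
    (λ -1≈0 → 1≉0 (trans (sym (-‿involutive 1#)) (trans (-‿cong -1≈0) -0#≈0#)))
    (sign-nonzero k)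

  alternating-repeat : ∀ {f : List (Vector Carrier m) → Carrier} → Alternating f →
    ∀ x xs ys → f (x ∷ xs ++ x ∷ ys) ≈ 0#
  alternating-repeat alt x []       ys = x≈-x⇒x≈0 (swap alt [] x x ys)
  alternating-repeat alt x (z ∷ xs) ys = trans (swap alt [] x z (xs ++ x ∷ ys))
    (trans (-‿cong (alternating-repeat (alternating-∷ alt z) x xs ys)) -0#≈0#)

  data Span {m} : List (Vector Carrier m) → Vector Carrier m → Set (c ⊔ ℓ) where
    nil  : x ≋ 0ᵛ → Span [] x
    cons : ∀ a y {z} → (∀ i → x i ≈ a * z i + y i) → Span xs y → Span (z ∷ xs) x

  span-resp : x ≋ y → Span xs x → Span xs y
  span-resp x≋y (nil x≋0)      = nil λ i → trans (sym (x≋y i)) (x≋0 i)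
  span-resp x≋y (cons a z eq s) = cons a z (λ i → trans (sym (x≋y i)) (eq i)) s

  span-0 : ∀ (xs : List (Vector Carrier m)) → x ≋ 0ᵛ → Span xs x
  span-0 []       x≋0 = nil x≋0
  span-0 (z ∷ xs) x≋0 = cons 0# 0ᵛ
    (λ i → trans (x≋0 i) (solve 1 (λ z → con (ℤ.+ 0) := con (ℤ.+ 0) :* z :+ con (ℤ.+ 0)) refl (z i)))
    (span-0 xs (λ _ → refl))

  span-combine : ∀ a b → Span xs x → Span xs y → Span xs (combine a x b y)
  span-combine a b (nil x≋0) (nil y≋0) = nil λ i →
    trans (+-cong (*-congˡ (x≋0 i)) (*-congˡ (y≋0 i)))
          (solve 2 (λ a b → a :* con (ℤ.+ 0) :+ b :* con (ℤ.+ 0) := con (ℤ.+ 0)) refl a b)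
  span-combine a b (cons a′ x′ {z} eq s) (cons b′ y′ eq′ s′) =
    cons (a * a′ + b * b′) (combine a x′ b y′)
      (λ i → trans (+-cong (*-congˡ (eq i)) (*-congˡ (eq′ i)))
        (solve 7 (λ a b a′ b′ z x y →
            a :* (a′ :* z :+ x) :+ b :* (b′ :* z :+ y) :=
            (a :* a′ :+ b :* b′) :* z :+ (a :* x :+ b :* y))
          refl a b a′ b′ (z i) (x′ i) (y′ i)))
      (span-combine a b s s′)

  span-scale : ∀ a → Span xs x → Span xs (a · x)
  span-scale {x = x} a s = span-resp
    (λ i → solve 2 (λ a x → a :* x :+ con (ℤ.+ 0) :* x := a :* x) refl a (x i))
    (span-combine a 0# s s)

  alternating-span : ∀ {f : List (Vector Carrier m) → Carrier} → Alternating f →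
    Span xs x → f (x ∷ xs) ≈ 0#
  alternating-span alt (nil x≋0) = alternating-zero alt _ [] x≋0
  alternating-span {x = x} {f = f} alt (cons {xs = xs} a y {z} eq s) = begin
    f (x ∷ z ∷ xs)
      ≈⟨ cong alt ((λ i → trans (eq i) (+-congˡ (sym (*-identityˡ (y i))))) ∷ ≋*-refl) ⟩
    f (combine a z 1# y ∷ z ∷ xs)
      ≈⟨ linear alt [] a z 1# y (z ∷ xs) ⟩
    a * f (z ∷ z ∷ xs) + 1# * f (y ∷ z ∷ xs)
      ≈⟨ +-cong (*-congˡ (alternating-repeat alt z [] xs))
                (*-congˡ (trans (swap alt [] y z xs) (-‿cong (alternating-span (alternating-∷ alt z) s)))) ⟩
    a * 0# + 1# * - 0#
      ≈⟨ solve 1 (λ a → a :* con (ℤ.+ 0) :+ con (ℤ.+ 1) :* (:- con (ℤ.+ 0)) := con (ℤ.+ 0)) refl a ⟩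
    0# ∎

  -- The first vector with a nonzero coefficient, expressed by the later ones
  data Dependent {m} : List (Vector Carrier m) → Set (c ⊔ ℓ) where
    here  : ∀ {b} → ¬ b ≈ 0# → Span xs (b · x) → Dependent (x ∷ xs)
    there : Dependent xs → Dependent (x ∷ xs)

  private
    ZeroHeads : List (Vector Carrier (suc m)) → Set _
    ZeroHeads = All (λ x → x zero ≈ 0#)

    span-tail : ZeroHeads xs → x zero ≈ 0# → Span (map tail xs) (tail x) → Span xs x
    span-tail []         x₀≈0 (nil x≋0) = nil λ { zero → x₀≈0 ; (suc i) → x≋0 i }
    span-tail (z₀≈0 ∷ h) x₀≈0 (cons a y eq s) = cons a (0# Vector.∷ y)
      (λ { zero → trans x₀≈0 (sym (trans (+-identityʳ _) (trans (*-congˡ z₀≈0) (zeroʳ a))))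
         ; (suc i) → eq i })
      (span-tail h refl s)

    dependent-tail : ZeroHeads xs → Dependent (map tail xs) → Dependent xs
    dependent-tail (x₀≈0 ∷ h) (here {b = b} b≉0 s) =
      here b≉0 (span-tail h (trans (*-congˡ x₀≈0) (zeroʳ b)) s)
    dependent-tail (_ ∷ h)    (there d)    = there (dependent-tail h d)

    -- Elimination with the last column that has a nonzero first entry only
    -- rescales the columns after it, so that dependence on later columns lifts.
    data Pivot {m} : List (Vector Carrier (suc m)) → Set (c ⊔ ℓ) where
      none : ZeroHeads xs → Pivot xs
      at   : ∀ xs x ys → ¬ x zero ≈ 0# → ZeroHeads ys → Pivot (xs ++ x ∷ ys)

    pivot : ∀ (xs : List (Vector Carrier (suc m))) → ¬ ¬ Pivot xs
    pivot []       k = k (none [])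
    pivot (x ∷ xs) k = pivot xs λ
      { (at ys y zs y₀≉0 h) → k (at (x ∷ ys) y zs y₀≉0 h)
      ; (none h) → ¬¬-excluded-middle λ
        { (yes x₀≈0) → k (none (x₀≈0 ∷ h))
        ; (no x₀≉0)  → k (at [] x xs x₀≉0 h) } }

    module Elimination {m} (q : Vector Carrier (suc m)) (q₀≉0 : ¬ q zero ≈ 0#) where
      q₀ = q zero

      clear : Vector Carrier (suc m) → Vector Carrier (suc m)
      clear x = combine q₀ x (- x zero) q

      clear-head : ∀ x → clear x zero ≈ 0#
      clear-head x = solve 2 (λ a b → a :* b :+ (:- b) :* a := con (ℤ.+ 0)) refl q₀ (x zero)

      -- Each cleared column contributes a factor `q₀`; the multiple of `q` in it contributes
      -- nothing by `f≈0`. The witness is thus a power of `q₀`.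
      alternating-clear : ∀ {f : List (Vector Carrier (suc m)) → Carrier} → Alternating f →
        (∀ ys → f (q ∷ ys) ≈ 0#) → ∀ xs → ∃[ a ] f (map clear xs) ≈ a * f xs
      alternating-clear alt f≈0 []       = 1# , sym (*-identityˡ _)
      alternating-clear {f} alt f≈0 (x ∷ xs) =
        let (a , eq) = alternating-clear (alternating-∷ alt x)
              (λ ys → trans (swap alt [] x q ys) (trans (-‿cong (f≈0 (x ∷ ys))) -0#≈0#)) xs
        in q₀ * a , (begin
          f (clear x ∷ map clear xs)
            ≈⟨ linear alt [] q₀ x (- x zero) q (map clear xs) ⟩
          q₀ * f (x ∷ map clear xs) + - x zero * f (q ∷ map clear xs)
            ≈⟨ +-cong (*-congˡ eq) (trans (*-congˡ (f≈0 _)) (zeroʳ _)) ⟩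
          q₀ * (a * f (x ∷ xs)) + 0#
            ≈⟨ solve 3 (λ p a f → p :* (a :* f) :+ con (ℤ.+ 0) := p :* a :* f) refl q₀ a _ ⟩
          q₀ * a * f (x ∷ xs) ∎)

      expand-zeroHeads : ∀ {f : List (Vector Carrier (suc m)) → Carrier} →
        ZeroHeads xs → expand xs f ≈ 0#
      expand-zeroHeads []         = refl
      expand-zeroHeads (x₀≈0 ∷ h) = trans
        (+-cong (trans (*-congʳ x₀≈0) (zeroˡ _)) (trans (-‿cong (expand-zeroHeads h)) -0#≈0#))
        (+-identityˡ 0#)

      -- With `q` in front and all other columns cleared, the expansion reduces to `q₀` times the
      -- minor of the cleared tails. The same determinant is a multiple of the original one, and
      -- `q₀` cancels.
      det-clear : ∀ xs ys → detCols (suc m) (xs ++ q ∷ ys) ≈ 0# →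
        detCols m (map (tail ∘ clear) (xs ++ ys)) ≈ 0#
      det-clear xs ys det≈0 =
        let (a , eq) = alternating-clear (alternating-∷ (detCols-alternating (suc m)) q)
                         (λ zs → alternating-repeat (detCols-alternating (suc m)) q [] zs) (xs ++ ys)
        in integral {q₀} (begin
          q₀ * detCols m (map (tail ∘ clear) (xs ++ ys))
            ≡⟨ ≡.cong (λ zs → q₀ * detCols m zs) (List.map-∘ (xs ++ ys)) ⟩
          q₀ * detCols m (map tail (map clear (xs ++ ys)))
            ≈⟨ +-identityʳ _ ⟨
          q₀ * detCols m (map tail (map clear (xs ++ ys))) + 0#
            ≈⟨ +-congˡ -0#≈0# ⟨
          q₀ * detCols m (map tail (map clear (xs ++ ys))) - 0#
            ≈⟨ +-congˡ (-‿cong (expand-zeroHeads (cleared (xs ++ ys)))) ⟨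
          detCols (suc m) (q ∷ map clear (xs ++ ys))
            ≈⟨ eq ⟩
          a * detCols (suc m) (q ∷ xs ++ ys)
            ≈⟨ *-congˡ (alternating-move (detCols-alternating (suc m)) q xs ys) ⟩
          a * ((- 1#) ^ length xs * detCols (suc m) (xs ++ q ∷ ys))
            ≈⟨ *-congˡ (*-congˡ det≈0) ⟩
          a * ((- 1#) ^ length xs * 0#)
            ≈⟨ trans (*-congˡ (zeroʳ _)) (zeroʳ a) ⟩
          0# ∎) q₀≉0
        where
        cleared : ∀ xs → ZeroHeads (map clear xs)
        cleared []       = []
        cleared (x ∷ xs) = clear-head x ∷ cleared xs

      span-clear₀ : ∀ {y} → ZeroHeads ys → Span (map (tail ∘ clear) ys) y → Span ys (0# Vector.∷ y)
      span-clear₀ []         (nil y≋0) = nil λ { zero → refl ; (suc i) → y≋0 i }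
      span-clear₀ (_∷_ {x = z} z₀≈0 h) (cons a y eq s) = cons (a * q₀) (0# Vector.∷ y)
        (λ { zero → sym (trans (+-identityʳ _) (trans (*-congˡ z₀≈0) (zeroʳ _)))
           ; (suc i) → trans (eq i) (+-congʳ (trans
               (*-congˡ (+-congˡ (trans (*-congʳ (trans (-‿cong z₀≈0) -0#≈0#)) (zeroˡ _))))
               (solve 3 (λ a p z → a :* (p :* z :+ con (ℤ.+ 0)) := a :* p :* z) refl a q₀ (z (suc i))))) })
        (span-clear₀ h s)

      span-clear : ∀ {x y} xs k → ZeroHeads ys → x zero ≈ k * q₀ →
        (∀ i → x (suc i) ≈ k * q (suc i) + y i) →
        Span (map (tail ∘ clear) (xs ++ ys)) y → Span (xs ++ q ∷ ys) x
      span-clear {y = y} [] k h x₀ xᵢ s = cons k (0# Vector.∷ y)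
        (λ { zero → trans x₀ (sym (+-identityʳ _)) ; (suc i) → xᵢ i })
        (span-clear₀ h s)
      span-clear {x = x} {y} (z ∷ xs) k h x₀ xᵢ (cons a y′ eq s) =
        cons (a * q₀) (combine 1# x (- (a * q₀)) z)
          (λ i → solve 3 (λ x b z → x := b :* z :+ (con (ℤ.+ 1) :* x :+ (:- b) :* z)) refl (x i) (a * q₀) (z i))
          (span-clear xs (k - a * z zero) h
            (trans (+-congʳ (*-congˡ x₀))
              (solve 4 (λ k p a z → con (ℤ.+ 1) :* (k :* p) :+ (:- (a :* p)) :* z := (k :- a :* z) :* p)
                refl k q₀ a (z zero)))
            (λ i → trans (+-congʳ (*-congˡ (trans (xᵢ i) (+-congˡ (eq i)))))
              (solve 7 (λ k p q a z₀ zᵢ y →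
                  con (ℤ.+ 1) :* (k :* q :+ (a :* (p :* zᵢ :+ (:- z₀) :* q) :+ y)) :+ (:- (a :* p)) :* zᵢ :=
                  (k :- a :* z₀) :* q :+ y)
                refl k q₀ (q (suc i)) a (z zero) (z (suc i)) (y′ i)))
            s)

      dependent-clear₀ : ZeroHeads ys → Dependent (map (tail ∘ clear) ys) → Dependent ys
      dependent-clear₀ (_∷_ {x = z} z₀≈0 h) (here {b = b} b≉0 s) = here (*-nonzero b≉0 q₀≉0)
        (span-resp
          (λ { zero → sym (trans (*-congˡ z₀≈0) (zeroʳ _))
             ; (suc i) → trans
                (*-congˡ (+-congˡ (trans (*-congʳ (trans (-‿cong z₀≈0) -0#≈0#)) (zeroˡ _))))
                (solve 3 (λ a p z → a :* (p :* z :+ con (ℤ.+ 0)) := a :* p :* z) refl b q₀ (z (suc i))) })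
          (span-clear₀ h s))
      dependent-clear₀ (_ ∷ h) (there d) = there (dependent-clear₀ h d)

      dependent-clear : ∀ xs → ZeroHeads ys →
        Dependent (map (tail ∘ clear) (xs ++ ys)) → Dependent (xs ++ q ∷ ys)
      dependent-clear []       h d            = there (dependent-clear₀ h d)
      dependent-clear (x ∷ xs) h (there d)    = there (dependent-clear xs h d)
      -- From `q₀ x = clear x + x₀ q`, scaled by `b`: the initial coefficient of `q` is
      -- `b * x zero`.
      dependent-clear (x ∷ xs) h (here {b = b} b≉0 s) = here (*-nonzero b≉0 q₀≉0)
        (span-clear xs (b * x zero) h
          (solve 3 (λ b p x → b :* p :* x := b :* x :* p) refl b q₀ (x zero))
          (λ i → solve 5 (λ b p x₀ xᵢ q → b :* p :* xᵢ := b :* x₀ :* q :+ b :* (p :* xᵢ :+ (:- x₀) :* q))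
            refl b q₀ (x zero) (x (suc i)) (q (suc i)))
          s)

  -- Gaussian elimination, one row at a time. The bound on the length is essential because `detCols`
  -- also vanishes on too few columns. Whether a pivot exists cannot be decided, hence the double
  -- negation.
  det≈0⇒dependent : ∀ m (xs : List (Vector Carrier m)) → m ℕ.≤ length xs →
    detCols m xs ≈ 0# → ¬ ¬ Dependent xs
  det≈0⇒dependent zero    []       _  1≈0 k = 1≉0 1≈0
  det≈0⇒dependent zero    (x ∷ xs) _  _   k = k (here 1≉0 (span-0 xs λ ()))
  det≈0⇒dependent (suc m) xs       m< det≈0 k = pivot xs λ
    { (none h) → det≈0⇒dependent m (map tail xs)
        (≡.subst (m ℕ.≤_) (≡.sym (List.length-map tail xs)) (ℕ.<⇒≤ m<))
        (detCols-wide m (map tail xs) (≡.subst (m ℕ.<_) (≡.sym (List.length-map tail xs)) m<))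
        (k ∘ dependent-tail h)
    ; (at ys q zs q₀≉0 h) → let open Elimination q q₀≉0 in
        det≈0⇒dependent m (map (tail ∘ clear) (ys ++ zs))
          (≡.subst (m ℕ.≤_) (≡.sym (List.length-map _ (ys ++ zs)))
            (ℕ.s≤s⁻¹ (≡.subst (suc m ℕ.≤_) (List.length-++-sucʳ ys q zs) m<)))
          (det-clear ys zs det≈0)
          (k ∘ dependent-clear ys h)
    }

-- Polynomial functions and cancellation of linear factors

module Polynomials {c ℓ p} {R : RawRing c ℓ} (D : OrderedDomain R p) where
  open OrderedDomain D
  open IntegerSolver commutativeRing
  open Determinants commutativeRing
  open LinearDependence D
  open Algebra.Properties.Ring ring
  open Relation.Binary.Reasoning.Setoid setoid

  private
    variable
      m : ℕ
      f g : Carrier → Carrier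

  -- Polynomial functions of degree less than the index, characterised by
  -- the quotient on division by any t - s
  Polynomial : ℕ → (Carrier → Carrier) → Set (c ⊔ ℓ)
  Polynomial zero    f = ∀ t → f t ≈ 0#
  Polynomial (suc n) f = ∀ s → ∃[ g ] Polynomial n g × (∀ t → f t ≈ f s + (t - s) * g t)

  polynomial-resp : ∀ n → (∀ t → f t ≈ g t) → Polynomial n f → Polynomial n g
  polynomial-resp zero    f≈g f≈0 t = trans (sym (f≈g t)) (f≈0 t)
  polynomial-resp (suc n) f≈g pf s =
    let (h , ph , eq) = pf s in
    h , ph , λ t → trans (sym (f≈g t)) (trans (eq t) (+-congʳ (f≈g s)))

  polynomial-const : ∀ n a → Polynomial (suc n) (λ _ → a)
  polynomial-0 : ∀ n → Polynomial n (λ _ → 0#)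
  polynomial-const n a s = (λ _ → 0#) , polynomial-0 n , λ t →
    sym (trans (+-congˡ (zeroʳ _)) (+-identityʳ a))
  polynomial-0 zero    t = refl
  polynomial-0 (suc n) = polynomial-const n 0#

  polynomial-suc : ∀ n → Polynomial n f → Polynomial (suc n) f
  polynomial-suc zero    f≈0 = polynomial-resp 1 (λ t → sym (f≈0 t)) (polynomial-0 1)
  polynomial-suc (suc n) pf s = let (g , pg , eq) = pf s in g , polynomial-suc n pg , eq

  polynomial-raise : ∀ k n → Polynomial n f → Polynomial (k ℕ.+ n) f
  polynomial-raise zero    n pf = pf
  polynomial-raise (suc k) n pf = polynomial-suc (k ℕ.+ n) (polynomial-raise k n pf)

  polynomial-combine : ∀ n a b → Polynomial n f → Polynomial n g →
    Polynomial n (λ t → a * f t + b * g t)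
  polynomial-combine zero a b f≈0 g≈0 t = trans
    (+-cong (*-congˡ (f≈0 t)) (*-congˡ (g≈0 t)))
    (solve 2 (λ a b → a :* con (ℤ.+ 0) :+ b :* con (ℤ.+ 0) := con (ℤ.+ 0)) refl a b)
  polynomial-combine {f} {g} (suc n) a b pf pg s =
    let (f′ , pf′ , eq) = pf s
        (g′ , pg′ , eq′) = pg s
    in (λ t → a * f′ t + b * g′ t) , polynomial-combine n a b pf′ pg′ , λ t →
      trans (+-cong (*-congˡ (eq t)) (*-congˡ (eq′ t)))
        (solve 8 (λ a b f g f′ g′ t s →
            a :* (f :+ (t :- s) :* f′) :+ b :* (g :+ (t :- s) :* g′) :=
            (a :* f :+ b :* g) :+ (t :- s) :* (a :* f′ :+ b :* g′))
          refl a b (f s) (g s) (f′ t) (g′ t) t s)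

  polynomial-affine-* : ∀ n a b → Polynomial n f → Polynomial (suc n) (λ t → (a + t * b) * f t)
  polynomial-affine-* zero a b f≈0 =
    polynomial-resp 1 (λ t → sym (trans (*-congˡ (f≈0 t)) (zeroʳ _))) (polynomial-0 1)
  polynomial-affine-* {f} (suc n) a b pf s =
    let (g , pg , eq) = pf s in
    -- Difference quotient of a product: `f` varies against the factor at `t`, and the affine
    -- factor, of slope `b`, varies against `f s`.
    (λ t → 1# * ((a + t * b) * g t) + b * f s) ,
    polynomial-combine (suc n) 1# b (polynomial-affine-* n a b pg) (polynomial-const n (f s)) ,
    λ t → trans (*-congˡ (eq t))
      (solve 6 (λ a b f g t s →
          (a :+ t :* b) :* (f :+ (t :- s) :* g) :=
          (a :+ s :* b) :* f :+ (t :- s) :* (con (ℤ.+ 1) :* ((a :+ t :* b) :* g) :+ b :* f))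
        refl a b (f s) (g t) t s)

  private
    points : Carrier → ℕ → Carrier
    points u zero    = u
    points u (suc k) = points (u + 1#) k

    points-above : ∀ u k → ∃[ d ] NonNeg d × points u k ≈ u + d
    points-above u zero    = 0# , nonNeg-resp (zeroˡ 0#) (nonNeg-square 0#) , sym (+-identityʳ u)
    points-above u (suc k) = let (d , d≥0 , eq) = points-above (u + 1#) k in
      1# + d , nonNeg-+ nonNeg-1 d≥0 , trans eq (+-assoc u 1# d)

    -- The difference is 1 plus a nonnegative element, so the order supplies characteristic zero and
    -- with it infinitely many distinct points.
    points-apart : ∀ u k → ¬ points (u + 1#) k - u ≈ 0#
    points-apart u k eq = let (d , d≥0 , eq′) = points-above (u + 1#) k in
      1≉0 (nonNeg-antisym nonNeg-1 d≥0 (begin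
        1# + d                 ≈⟨ solve 3 (λ u e d → e :+ d := u :+ e :+ d :- u) refl u 1# d ⟩
        u + 1# + d - u         ≈⟨ +-congʳ eq′ ⟨
        points (u + 1#) k - u  ≈⟨ eq ⟩
        0#                     ∎))

    -- Dividing by `t - u` lowers the degree bound, and the quotient inherits the zeros `u + 1`,
    -- `u + 2`, and so on, where `t - u` is nonzero.
    polynomial-vanish : ∀ n u → Polynomial n f → (∀ k → f (points u k) ≈ 0#) → ∀ t → f t ≈ 0#
    polynomial-vanish zero    u f≈0 _ = f≈0
    polynomial-vanish {f} (suc n) u pf roots t =
      let (g , pg , eq) = pf u
          eq′ : ∀ t → f t ≈ (t - u) * g t
          eq′ = λ t → trans (eq t) (trans (+-congʳ (roots 0)) (+-identityˡ _))
          g≈0 = polynomial-vanish n (u + 1#) pg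
            (λ k → integral (trans (sym (eq′ _)) (roots (suc k))) (points-apart u k))
      in trans (eq′ t) (trans (*-congˡ (g≈0 t)) (zeroʳ _))

  -- At `t = a` the hypothesis is empty, so the zeros of `f` are collected from `a + 1` onwards.
  polynomial-cancel : ∀ n a → Polynomial n f → (∀ t → (t - a) * f t ≈ 0#) → ∀ t → f t ≈ 0#
  polynomial-cancel n a pf eq =
    polynomial-vanish n (a + 1#) pf (λ k → integral (eq _) (points-apart a k))

  affine : Vector Carrier m × Vector Carrier m → Carrier → Vector Carrier m
  affine (x , y) t i = x i + t * y i

  private
    polynomial-expand : ∀ n {f : Carrier → List (Vector Carrier (suc m)) → Carrier} →
      (∀ xs → Polynomial n (λ t → f t (map (λ x → affine x t) xs))) →
      ∀ xs → Polynomial (suc n) (λ t → expand (map (λ x → affine x t) xs) (f t))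
    polynomial-expand n pf [] = polynomial-0 (suc n)
    polynomial-expand n {f} pf ((x , y) ∷ xs) = polynomial-resp (suc n)
      (λ t → +-cong (*-identityˡ _) (-1*x≈-x _))
      (polynomial-combine (suc n) 1# (- 1#)
        (polynomial-affine-* n (x zero) (y zero) (pf xs))
        (polynomial-expand n {λ t ys → f t (affine (x , y) t ∷ ys)} (λ ys → pf ((x , y) ∷ ys)) xs))

  polynomial-detCols : ∀ m xs → Polynomial (suc m) (λ t → detCols m (map (λ x → affine x t) xs))
  polynomial-detCols zero    []      = polynomial-const 0 1#
  polynomial-detCols zero    (_ ∷ _) = polynomial-0 1
  polynomial-detCols (suc m) xs = polynomial-expand (suc m) {λ t ys → detCols m (map tail ys)}
    (λ ys → polynomial-resp (suc m)
      (λ t → reflexive (≡.cong (detCols m) (≡.trans (≡.sym (List.map-∘ ys)) (List.map-∘ ys))))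
      (polynomial-detCols m (map (λ (x , y) → tail x , tail y) ys)))
    xs

  monicProduct : List Carrier → Carrier → Carrier
  monicProduct []       t = 1#
  monicProduct (a ∷ as) t = (t - a) * monicProduct as t

  polynomial-monicProduct : ∀ as → Polynomial (suc (length as)) (monicProduct as)
  polynomial-monicProduct []       = polynomial-const 0 1#
  polynomial-monicProduct (a ∷ as) = polynomial-resp (suc (suc (length as)))
    (λ t → *-congʳ (trans (+-comm _ _) (+-congʳ (*-identityʳ t))))
    (polynomial-affine-* (suc (length as)) (- a) 1# (polynomial-monicProduct as))

  monicProduct-nonzero : ∀ as → ¬ (∀ t → monicProduct as t ≈ 0#)
  monicProduct-nonzero []       eq = 1≉0 (eq 0#)
  monicProduct-nonzero (a ∷ as) eq =
    monicProduct-nonzero as (polynomial-cancel (suc (length as)) a (polynomial-monicProduct as) eq)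

-- Inner product and matrix action

module InnerProduct {c ℓ p} {R : RawRing c ℓ} (D : OrderedDomain R p) where
  open OrderedDomain D
  open IntegerSolver commutativeRing
  open Determinants commutativeRing
  open LinearDependence D
  open Algebra.Properties.Semiring.Sum semiring using (sum; sum-cong-≋; *-distribˡ-sum; *-distribʳ-sum; ∑-distrib-+; ∑-comm)
  open Relation.Binary.Reasoning.Setoid setoid

  private
    variable
      m : ℕ
      x y z : Vector Carrier m
      xs : List (Vector Carrier m)

  sum-combine : ∀ a (x : Vector Carrier m) b y → sum (combine a x b y) ≈ a * sum x + b * sum y
  sum-combine a x b y = trans (∑-distrib-+ (λ i → a * x i) (λ i → b * y i))
    (sym (+-cong (*-distribˡ-sum a x) (*-distribˡ-sum b y)))

  sum-nonNeg : ∀ (x : Vector Carrier m) → (∀ i → NonNeg (x i)) → NonNeg (sum x)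
  sum-nonNeg {zero}  x x≥0 = nonNeg-resp (zeroˡ 0#) (nonNeg-square 0#)
  sum-nonNeg {suc m} x x≥0 = nonNeg-+ (x≥0 zero) (sum-nonNeg (x ∘ suc) (x≥0 ∘ suc))

  infix 7 ⟨_,_⟩
  ⟨_,_⟩ : Vector Carrier m → Vector Carrier m → Carrier
  ⟨ x , y ⟩ = sum λ i → x i * y i

  ⟨⟩-cong : ∀ {x x′ y y′ : Vector Carrier m} → x ≋ x′ → y ≋ y′ → ⟨ x , y ⟩ ≈ ⟨ x′ , y′ ⟩
  ⟨⟩-cong p q = sum-cong-≋ λ i → *-cong (p i) (q i)

  ⟨⟩-comm : ∀ (x y : Vector Carrier m) → ⟨ x , y ⟩ ≈ ⟨ y , x ⟩
  ⟨⟩-comm x y = sum-cong-≋ λ i → *-comm (x i) (y i)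

  ⟨⟩-combineˡ : ∀ a (x : Vector Carrier m) b y z →
    ⟨ combine a x b y , z ⟩ ≈ a * ⟨ x , z ⟩ + b * ⟨ y , z ⟩
  ⟨⟩-combineˡ a x b y z = trans
    (sum-cong-≋ λ i → solve 5 (λ a x b y z → (a :* x :+ b :* y) :* z := a :* (x :* z) :+ b :* (y :* z))
                        refl a (x i) b (y i) (z i))
    (sum-combine a (λ i → x i * z i) b (λ i → y i * z i))

  ⟨⟩-combineʳ : ∀ (z : Vector Carrier m) a x b y →
    ⟨ z , combine a x b y ⟩ ≈ a * ⟨ z , x ⟩ + b * ⟨ z , y ⟩
  ⟨⟩-combineʳ z a x b y = trans (⟨⟩-comm z (combine a x b y))
    (trans (⟨⟩-combineˡ a x b y z) (+-cong (*-congˡ (⟨⟩-comm x z)) (*-congˡ (⟨⟩-comm y z))))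

  ⟨⟩-scaleʳ : ∀ (x : Vector Carrier m) a y → ⟨ x , a · y ⟩ ≈ a * ⟨ x , y ⟩
  ⟨⟩-scaleʳ x a y = trans
    (sum-cong-≋ λ i → solve 3 (λ x a y → x :* (a :* y) := a :* (x :* y)) refl (x i) a (y i))
    (sym (*-distribˡ-sum a (λ i → x i * y i)))

  ⟨⟩-zeroʳ : ∀ (x : Vector Carrier m) → y ≋ 0ᵛ → ⟨ x , y ⟩ ≈ 0#
  ⟨⟩-zeroʳ {y = y} x y≋0 = begin
    ⟨ x , y ⟩         ≈⟨ ⟨⟩-cong {x = x} (λ _ → refl) (λ i → trans (y≋0 i) (sym (zeroˡ (y i)))) ⟩
    ⟨ x , 0# · y ⟩    ≈⟨ ⟨⟩-scaleʳ x 0# y ⟩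
    0# * ⟨ x , y ⟩    ≈⟨ zeroˡ _ ⟩
    0#                ∎

  ⟨⟩-nonNeg : ∀ (x : Vector Carrier m) → NonNeg ⟨ x , x ⟩
  ⟨⟩-nonNeg x = sum-nonNeg _ (λ i → nonNeg-square (x i))

  x*x≈0⇒¬¬x≈0 : ∀ {a} → a * a ≈ 0# → ¬ ¬ a ≈ 0#
  x*x≈0⇒¬¬x≈0 a²≈0 a≉0 = a≉0 (integral a²≈0 a≉0)

  -- Nonnegative terms with zero sum vanish one by one. Going from a square to its root costs a
  -- double negation, as `integral` asks for a nonzero factor.
  ⟨⟩-definite : ∀ (x : Vector Carrier m) → ⟨ x , x ⟩ ≈ 0# → ¬ ¬ x ≋ 0ᵛ
  ⟨⟩-definite {zero}  x eq k = k λ ()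
  ⟨⟩-definite {suc m} x eq k =
    x*x≈0⇒¬¬x≈0 (nonNeg-antisym (nonNeg-square (x zero)) (⟨⟩-nonNeg (x ∘ suc)) eq) λ x₀≈0 →
    ⟨⟩-definite (x ∘ suc)
      (nonNeg-antisym (⟨⟩-nonNeg (x ∘ suc)) (nonNeg-square (x zero)) (trans (+-comm _ _) eq)) λ xᵢ≈0 →
    k λ { zero → x₀≈0 ; (suc i) → xᵢ≈0 i }

  ⟨⟩-span : ∀ {x u : Vector Carrier m} → All (λ y → ⟨ x , y ⟩ ≈ 0#) xs → Span xs u → ⟨ x , u ⟩ ≈ 0#
  ⟨⟩-span {x = x} [] (nil u≋0) = ⟨⟩-zeroʳ x u≋0
  ⟨⟩-span {x = x} {u} (x⊥z ∷ x⊥xs) (cons a y {z} eq s) = begin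
    ⟨ x , u ⟩                        ≈⟨ ⟨⟩-cong {x = x} (λ _ → refl) (λ i → trans (eq i) (+-congˡ (sym (*-identityˡ (y i))))) ⟩
    ⟨ x , combine a z 1# y ⟩         ≈⟨ ⟨⟩-combineʳ x a z 1# y ⟩
    a * ⟨ x , z ⟩ + 1# * ⟨ x , y ⟩   ≈⟨ +-cong (*-congˡ x⊥z) (*-congˡ (⟨⟩-span x⊥xs s)) ⟩
    a * 0# + 1# * 0#                 ≈⟨ trans (+-cong (zeroʳ _) (zeroʳ _)) (+-identityˡ 0#) ⟩
    0#                               ∎

  module _ (A : Matrix Carrier m) where

    apply : Vector Carrier m → Vector Carrier m
    apply x i = ⟨ A i , x ⟩

    apply-cong : x ≋ y → apply x ≋ apply y
    apply-cong x≋y i = ⟨⟩-cong {x = A i} (λ _ → refl) x≋y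

    apply-combine : ∀ a x b y → apply (combine a x b y) ≋ combine a (apply x) b (apply y)
    apply-combine a x b y i = ⟨⟩-combineʳ (A i) a x b y

    apply-symmetric : (∀ i j → A i j ≈ A j i) → ∀ x y → ⟨ apply x , y ⟩ ≈ ⟨ x , apply y ⟩
    apply-symmetric sym-A x y = begin
      sum (λ i → apply x i * y i)
        ≈⟨ sum-cong-≋ (λ i → *-distribʳ-sum (y i) (λ j → A i j * x j)) ⟩
      sum (λ i → sum (λ j → A i j * x j * y i))
        ≈⟨ ∑-comm (λ i j → A i j * x j * y i) ⟩
      sum (λ j → sum (λ i → A i j * x j * y i))
        ≈⟨ sum-cong-≋ (λ j → sum-cong-≋ (λ i → trans (*-congʳ (*-congʳ (sym-A i j)))
             (solve 3 (λ a x y → a :* x :* y := x :* (a :* y)) refl (A j i) (x j) (y i)))) ⟩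
      sum (λ j → sum (λ i → x j * (A j i * y i)))
        ≈⟨ sum-cong-≋ (λ j → sym (*-distribˡ-sum (x j) (λ i → A j i * y i))) ⟩
      sum (λ j → x j * apply y j)
        ∎

    shift : Carrier → Vector Carrier m → Vector Carrier m
    shift t x i = t * x i - apply x i

    shift-cong : ∀ t → x ≋ y → shift t x ≋ shift t y
    shift-cong t x≋y i = +-cong (*-congˡ (x≋y i)) (-‿cong (apply-cong x≋y i))

    shift-combine : ∀ t a x b y → shift t (combine a x b y) ≋ combine a (shift t x) b (shift t y)
    shift-combine t a x b y i = trans (+-congˡ (-‿cong (apply-combine a x b y i)))
      (solve 7 (λ t a x b y u v → t :* (a :* x :+ b :* y) :- (a :* u :+ b :* v) :=
                                  a :* (t :* x :- u) :+ b :* (t :* y :- v))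
        refl t a (x i) b (y i) (apply x i) (apply y i))

-- Orthogonal eigenvectors from the factored characteristic polynomial

module Eigenvectors {c ℓ p} {R : RawRing c ℓ} (D : OrderedDomain R p) {m}
  (A : Matrix (RawRing.Carrier R) m) (A-symmetric : ∀ i j → RawRing._≈_ R (A i j) (A j i)) where
  open OrderedDomain D
  open IntegerSolver commutativeRing
  open Determinants commutativeRing
  open Alternating
  open LinearDependence D
  open Polynomials D
  open InnerProduct D
  open Algebra.Properties.Ring ring
  open RawSemiringDefinitions (RawRing.rawSemiring R) using (_^_)
  open Relation.Binary.Reasoning.Setoid setoid

  private
    V = Vector Carrier m

  vectors : List (Carrier × V) → List V
  vectors = map proj₂

  infix 4 _⊥_
  _⊥_ : V → List V → Set _
  x ⊥ xs = All (λ y → ⟨ x , y ⟩ ≈ 0#) xs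

  -- Nonvanishing is demanded of `⟨ v , v ⟩`, since this is the scalar that later gets cancelled by
  -- `integral`.
  data OrthogonalEigenpairs : List (Carrier × V) → Set (c ⊔ ℓ) where
    []   : OrthogonalEigenpairs []
    cons : ∀ {r v vs} → apply A v ≋ r · v → ¬ ⟨ v , v ⟩ ≈ 0# → v ⊥ vectors vs →
           OrthogonalEigenpairs vs → OrthogonalEigenpairs ((r , v) ∷ vs)

  -- Pairing a dependence with its leading vector `v` leaves `b * ⟨ v , v ⟩ = 0`.
  orthogonal⇒independent : ∀ {vs} → OrthogonalEigenpairs vs → ¬ Dependent (vectors vs)
  orthogonal⇒independent (cons {v = v} _ v≉0 v⊥vs o) (here {b = b} b≉0 s) =
    v≉0 (integral (trans (sym (⟨⟩-scaleʳ v b v)) (⟨⟩-span v⊥vs s)) b≉0)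
  orthogonal⇒independent (cons _ _ _ o) (there d) = orthogonal⇒independent o d

  -- Gram-Schmidt without division: rather than subtracting `a / q` times `v`, the vector is first
  -- multiplied by `q = ⟨ v , v ⟩`. The nonzero scalar `k` collects these norms.
  orthogonalise : ∀ {vs} → OrthogonalEigenpairs vs → ∀ (w : V) →
    ∃[ k ] ∃[ w′ ] ∃[ s ] ¬ k ≈ 0# × w′ ⊥ vectors vs × Span (vectors vs) s ×
    (∀ i → w′ i ≈ k * w i + s i)
  orthogonalise [] w = 1# , w , 0ᵛ , 1≉0 , [] , nil (λ _ → refl) ,
    λ i → sym (trans (+-identityʳ _) (*-identityˡ (w i)))
  orthogonalise {(r , v) ∷ vs} (cons _ v≉0 v⊥vs o) w =
    let (k , w′ , s , k≉0 , w′⊥vs , s∈ , eq) = orthogonalise o w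
        q = ⟨ v , v ⟩
        a = ⟨ w′ , v ⟩
    in q * k , combine q w′ (- a) v , combine q s (- a) v ,
       *-nonzero v≉0 k≉0 ,
       trans (⟨⟩-combineˡ q w′ (- a) v v)
         (solve 2 (λ q a → q :* a :+ (:- a) :* q := con (ℤ.+ 0)) refl q a) ∷
       All.zipWith (λ {z} (w′⊥z , v⊥z) → trans (⟨⟩-combineˡ q w′ (- a) v z)
           (trans (+-cong (trans (*-congˡ w′⊥z) (zeroʳ _)) (trans (*-congˡ v⊥z) (zeroʳ _))) (+-identityˡ 0#)))
         (w′⊥vs , v⊥vs) ,
       cons (- a) (q · s) (λ i → +-comm _ _) (span-scale q s∈) ,
       λ i → trans (+-congʳ (*-congˡ (eq i)))
         (solve 6 (λ q k w s a v → q :* (k :* w :+ s) :+ (:- a) :* v := q :* k :* w :+ (q :* s :+ (:- a) :* v))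
           refl q k (w i) (s i) a (v i))

  shift-span : ∀ {vs x} t → OrthogonalEigenpairs vs → Span (vectors vs) x → Span (vectors vs) (shift A t x)
  shift-span t [] (nil x≋0) = nil λ i → trans
    (+-cong (trans (*-congˡ (x≋0 i)) (zeroʳ t)) (trans (-‿cong (⟨⟩-zeroʳ (A i) x≋0)) -0#≈0#))
    (+-identityˡ 0#)
  shift-span t (cons {r} {v} eigen _ _ o) (cons a y eq s) = cons (a * (t - r)) (shift A t y)
    (λ i → trans (shift-cong A t (λ i → trans (eq i) (+-congˡ (sym (*-identityˡ (y i))))) i)
      (trans (shift-combine A t a v 1# y i)
        (trans (+-cong (*-congˡ (+-congˡ (-‿cong (eigen i)))) (*-identityˡ _))
          (solve 5 (λ a t r v u → a :* (t :* v :- r :* v) :+ u := a :* (t :- r) :* v :+ u)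
            refl a t r (v i) (shift A t y i)))))
    (shift-span t o s)

  -- Symmetry of `A` moves it onto the eigenvector, so the orthogonal complement of eigenvectors is
  -- invariant.
  shift-⊥ : ∀ {vs x} t → OrthogonalEigenpairs vs → x ⊥ vectors vs → shift A t x ⊥ vectors vs
  shift-⊥ t [] [] = []
  shift-⊥ {x = x} t (cons {r} {v} eigen _ _ o) (x⊥v ∷ x⊥vs) = (begin
    ⟨ shift A t x , v ⟩
      ≈⟨ ⟨⟩-cong {y = v} (λ i → +-congˡ (sym (-1*x≈-x _))) (λ _ → refl) ⟩
    ⟨ combine t x (- 1#) (apply A x) , v ⟩
      ≈⟨ ⟨⟩-combineˡ t x (- 1#) (apply A x) v ⟩
    t * ⟨ x , v ⟩ + - 1# * ⟨ apply A x , v ⟩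
      ≈⟨ +-cong (*-congˡ x⊥v) (*-congˡ (apply-symmetric A A-symmetric x v)) ⟩
    t * 0# + - 1# * ⟨ x , apply A v ⟩
      ≈⟨ +-congˡ (*-congˡ (trans (⟨⟩-cong {x = x} (λ _ → refl) eigen) (⟨⟩-scaleʳ x r v))) ⟩
    t * 0# + - 1# * (r * ⟨ x , v ⟩)
      ≈⟨ +-congˡ (*-congˡ (*-congˡ x⊥v)) ⟩
    t * 0# + - 1# * (r * 0#)
      ≈⟨ solve 3 (λ t e r → t :* con (ℤ.+ 0) :+ e :* (r :* con (ℤ.+ 0)) := con (ℤ.+ 0)) refl t (- 1#) r ⟩
    0# ∎) ∷ shift-⊥ t o x⊥vs

  span∩⊥ : ∀ {xs x} → Span xs x → x ⊥ xs → ¬ ¬ x ≋ 0ᵛ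
  span∩⊥ {x = x} s x⊥xs = ⟨⟩-definite x (⟨⟩-span x⊥xs s)

  -- A dependence led by a column `g vector` still to be replaced. As `Dependent` expresses its
  -- vector by later ones and `xs` stands last, independence of `xs` forces the leader to come from
  -- `es`.
  record Relation (g : V → V) (es xs : List V) : Set (c ⊔ ℓ) where
    field
      before after : List V
      vector       : V
      split        : es ≡ before ++ vector ∷ after
      coefficient  : Carrier
      nonzero      : ¬ coefficient ≈ 0#
      spanned      : Span (map g after ++ xs) (coefficient · g vector)

  relation : ∀ g es {xs} → ¬ Dependent xs → Dependent (map g es ++ xs) → Relation g es xs
  relation g []       ind d            = contradiction d ind
  relation g (e ∷ es) ind (here b≉0 s) = record
    { before = [] ; after = es ; vector = e ; split = ≡.refl ; nonzero = b≉0 ; spanned = s }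
  relation g (e ∷ es) ind (there d)    = let open Relation (relation g es ind d) in record
    { before = e ∷ before ; split = ≡.cong (e ∷_) split ; nonzero = nonzero ; spanned = spanned }

  span-split : ∀ t es {xs x} → Span (map (shift A t) es ++ xs) x →
    ∃[ u ] Span es u × Span xs (combine 1# x (- 1#) (shift A t u))
  span-split t [] {x = x} s = 0ᵛ , nil (λ _ → refl) , span-resp
    (λ i → sym (trans
      (+-congˡ (*-congˡ (trans
        (+-cong (zeroʳ t) (trans (-‿cong (⟨⟩-zeroʳ {y = 0ᵛ} (A i) λ _ → refl)) -0#≈0#))
        (+-identityˡ 0#))))
      (solve 3 (λ x e f → e :* x :+ f :* con (ℤ.+ 0) := e :* x) refl (x i) 1# (- 1#))))
    (span-scale 1# s)
  span-split t (e ∷ es) {x = x} (cons a y eq s) =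
    let (u , u∈ , rest) = span-split t es s in
    combine a e 1# u , cons a u (λ i → +-congˡ (*-identityˡ (u i))) u∈ , span-resp
      (λ i → sym (trans (+-cong (*-congˡ (eq i)) (*-congˡ (shift-combine A t a e 1# u i)))
        (solve 4 (λ a z y u →
            con (ℤ.+ 1) :* (a :* z :+ y) :+ (:- con (ℤ.+ 1)) :* (a :* z :+ con (ℤ.+ 1) :* u) :=
            con (ℤ.+ 1) :* y :+ (:- con (ℤ.+ 1)) :* u)
          refl a (shift A t e i) (y i) (shift A t u i))))
      rest

  span-++ˡ : ∀ xs {ys} {x : V} → Span ys x → Span (xs ++ ys) x
  span-++ˡ []       s = s
  span-++ˡ (z ∷ xs) {x = x} s = cons 0# x
    (λ i → sym (trans (+-congʳ (zeroˡ (z i))) (+-identityˡ (x i)))) (span-++ˡ xs s)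

  span-++ʳ : ∀ {xs ys} {x : V} → Span xs x → Span (xs ++ ys) x
  span-++ʳ {ys = ys} (nil x≋0)      = span-0 ys x≋0
  span-++ʳ           (cons a y eq s) = cons a y eq (span-++ʳ s)

  span-map-shift : ∀ t {es x} → Span es x → Span (map (shift A t) es) (shift A t x)
  span-map-shift t (nil x≋0) = shift-span t [] (nil x≋0)
  span-map-shift t (cons a y {z} eq s) = cons a (shift A t y)
    (λ i → trans (shift-cong A t (λ i → trans (eq i) (+-congˡ (sym (*-identityˡ (y i))))) i)
      (trans (shift-combine A t a z 1# y i) (+-congˡ (*-identityˡ _))))
    (span-map-shift t s)

  alternating-++ : ∀ {f : List V → Carrier} xs → Alternating f → Alternating (f ∘ (xs ++_))
  alternating-++ []       alt = alt
  alternating-++ (x ∷ xs) alt = alternating-++ xs (alternating-∷ alt x)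

  -- The partially deflated characteristic determinant: eigenvectors already found enter as columns
  -- constant in `t`.
  pencil : List V → List (Carrier × V) → Carrier → Carrier
  pencil es vs t = detCols m (map (shift A t) es ++ vectors vs)

  polynomial-pencil : ∀ es vs → Polynomial (suc m) (pencil es vs)
  polynomial-pencil es vs = polynomial-resp (suc m)
    (λ t → cong (detCols-alternating m) (columns t es)) (polynomial-detCols m (affineColumns es))
    where
    constants : List (V × V)
    constants = map (_, 0ᵛ) (vectors vs)

    affineColumns : List V → List (V × V)
    affineColumns es = map (λ e → (λ i → - apply A e i) , e) es ++ constants

    columns : ∀ t es → map (λ x → affine x t) (affineColumns es) ≋* map (shift A t) es ++ vectors vs
    columns t []       = go (vectors vs)
      where
      go : ∀ xs → map (λ x → affine x t) (map (_, 0ᵛ) xs) ≋* xs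
      go []       = []
      go (x ∷ xs) = (λ i → trans (+-congˡ (zeroʳ t)) (+-identityʳ (x i))) ∷ go xs
    columns t (e ∷ es) = (λ i → +-comm _ _) ∷ columns t es

  -- One replacement step. `α` and `β` collect the signs and column multipliers that would otherwise
  -- have to be divided out.
  module Deflation {vs} (o : OrthogonalEigenpairs vs) {es a as α β} (α≉0 : ¬ α ≈ 0#) (β≉0 : ¬ β ≈ 0#)
    (factored : ∀ t → α * pencil es vs t ≈ β * monicProduct (a ∷ as) t)
    (rel : Relation (shift A a) es (vectors vs)) where
    open Relation rel

    private
      splitting = span-split a after spanned
      u   = proj₁ splitting
      u∈  = proj₁ (proj₂ splitting)
      -- Moving `u` to the left side of the relation makes `(a - A) w₀` a combination of the
      -- eigenvectors in `vs`; adding such eigenvectors in `orthogonalise` preserves this.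
      w₀  = combine coefficient vector (- 1#) u
      orthogonalised = orthogonalise o w₀
      k   = proj₁ orthogonalised
      w   = proj₁ (proj₂ orthogonalised)
      s   = proj₁ (proj₂ (proj₂ orthogonalised))
      k≉0 = proj₁ (proj₂ (proj₂ (proj₂ orthogonalised)))
      w⊥  = proj₁ (proj₂ (proj₂ (proj₂ (proj₂ orthogonalised))))
      s∈  = proj₁ (proj₂ (proj₂ (proj₂ (proj₂ (proj₂ orthogonalised)))))
      w-def = proj₂ (proj₂ (proj₂ (proj₂ (proj₂ (proj₂ orthogonalised)))))

    remaining : List V
    remaining = before ++ after

    private
      shift-w : ∀ t i → shift A t w i ≈
        k * (coefficient * shift A t vector i + - 1# * shift A t u i) + shift A t s i
      shift-w t i = begin
        shift A t w i
          ≈⟨ shift-cong A t (λ i → trans (w-def i) (+-congˡ (sym (*-identityˡ (s i))))) i ⟩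
        shift A t (combine k w₀ 1# s) i
          ≈⟨ shift-combine A t k w₀ 1# s i ⟩
        k * shift A t w₀ i + 1# * shift A t s i
          ≈⟨ +-cong (*-congˡ (shift-combine A t coefficient vector (- 1#) u i)) (*-identityˡ _) ⟩
        k * (coefficient * shift A t vector i + - 1# * shift A t u i) + shift A t s i ∎

      shift-w∈ : Span (vectors vs) (shift A a w)
      shift-w∈ = span-resp
        (λ i → trans (+-cong (*-congˡ (+-congʳ (*-identityˡ _))) (*-identityˡ _)) (sym (shift-w a i)))
        (span-combine k 1# (proj₂ (proj₂ splitting)) (shift-span a o s∈))

    -- `(a - A) w` lies in the span of the known eigenvectors and is orthogonal to all of them.
    shift-eigenvector : ¬ ¬ shift A a w ≋ 0ᵛ
    shift-eigenvector = span∩⊥ shift-w∈ (shift-⊥ a o w⊥)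

    module _ (shift-w≋0 : shift A a w ≋ 0ᵛ) where

      private
        eigen : apply A w ≋ a · w
        eigen i = begin
          apply A w i                              ≈⟨ solve 2 (λ x y → x := y :- (y :- x)) refl (apply A w i) (a * w i) ⟩
          a * w i - (a * w i - apply A w i)        ≈⟨ +-congˡ (trans (-‿cong (shift-w≋0 i)) -0#≈0#) ⟩
          a * w i + 0#                             ≈⟨ +-identityʳ _ ⟩
          a * w i                                  ∎

        alt = detCols-alternating m
        σ₁ = (- 1#) ^ length before
        σ₂ = (- 1#) ^ length remaining

      α′ β′ : Carrier
      -- `σ₁` is the sign of moving `w` to the front from the place of `vector`, `σ₂` that of moving
      -- it from the front to behind `remaining`; `k * coefficient` is the multiple of `vector`
      -- contained in `w`.
      α′ = α * σ₂
      β′ = σ₁ * (k * coefficient) * β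

      α′≉0 : ¬ α′ ≈ 0#
      α′≉0 = *-nonzero α≉0 (sign-nonzero (length remaining))

      β′≉0 : ¬ β′ ≈ 0#
      β′≉0 = *-nonzero (*-nonzero (sign-nonzero (length before)) (*-nonzero k≉0 nonzero)) β≉0

      private
        new : Carrier → Carrier
        new = pencil remaining ((a , w) ∷ vs)

        module _ (t : Carrier) where
          g = shift A t
          tailColumns = map g after ++ vectors vs

          X : Carrier
          X = detCols m (map g before ++ w ∷ tailColumns)

          columns-remaining : map g remaining ++ vectors vs ≡ map g before ++ tailColumns
          columns-remaining = ≡.trans (≡.cong (_++ vectors vs) (List.map-++ g before after))
            (List.++-assoc (map g before) (map g after) (vectors vs))

          columns-es : map g es ++ vectors vs ≡ map g before ++ g vector ∷ tailColumns
          columns-es = ≡.trans (≡.cong (λ es → map g es ++ vectors vs) split)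
            (≡.trans (≡.cong (_++ vectors vs) (List.map-++ g before (vector ∷ after)))
              (List.++-assoc (map g before) (g vector ∷ map g after) (vectors vs)))

          move-new : σ₂ * new t ≈ detCols m (w ∷ map g remaining ++ vectors vs)
          move-new = trans (*-congʳ (reflexive (≡.cong ((- 1#) ^_) (≡.sym (List.length-map g remaining)))))
            (sym (alternating-move alt w (map g remaining) (vectors vs)))

          move-X : σ₁ * X ≈ σ₂ * new t
          move-X = begin
            σ₁ * X
              ≡⟨ ≡.cong (λ n → (- 1#) ^ n * X) (List.length-map g before) ⟨
            (- 1#) ^ length (map g before) * X
              ≈⟨ alternating-move alt w (map g before) tailColumns ⟨
            detCols m (w ∷ map g before ++ tailColumns)
              ≡⟨ ≡.cong (λ xs → detCols m (w ∷ xs)) columns-remaining ⟨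
            detCols m (w ∷ map g remaining ++ vectors vs)
              ≈⟨ move-new ⟨
            σ₂ * new t ∎

          f : List V → Carrier
          f xs = detCols m (map g before ++ xs)

          alt-f : Alternating f
          alt-f = alternating-++ (map g before) alt

          y : V
          y = combine (- k) (g u) 1# (g s)

          y∈ : Span tailColumns y
          y∈ = span-combine (- k) 1# (span-++ʳ (span-map-shift t u∈))
                 (span-++ˡ (map g after) (shift-span t o s∈))

          -- For the eigenvector `w`, the column `(t - a) w` equals `(t - A) w`. This is
          -- `k * coefficient` times the replaced column plus `y`, and `y` lies in the span of the
          -- later columns.
          expand-X : (t - a) * X ≈ k * coefficient * pencil es vs t
          expand-X = begin
            (t - a) * X
              ≈⟨ trans (+-congˡ (zeroˡ X)) (+-identityʳ _) ⟨
            (t - a) * X + 0# * X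
              ≈⟨ linear alt-f [] (t - a) w 0# w tailColumns ⟨
            f (combine (t - a) w 0# w ∷ tailColumns)
              ≈⟨ cong alt-f (columns ∷ ≋*-refl) ⟩
            f (combine (k * coefficient) (g vector) 1# y ∷ tailColumns)
              ≈⟨ linear alt-f [] (k * coefficient) (g vector) 1# y tailColumns ⟩
            k * coefficient * f (g vector ∷ tailColumns) + 1# * f (y ∷ tailColumns)
              ≈⟨ +-congˡ (trans (*-congˡ (alternating-span alt-f y∈)) (zeroʳ 1#)) ⟩
            k * coefficient * f (g vector ∷ tailColumns) + 0#
              ≈⟨ +-identityʳ _ ⟩
            k * coefficient * f (g vector ∷ tailColumns)
              ≡⟨ ≡.cong (λ xs → k * coefficient * detCols m xs) columns-es ⟨
            k * coefficient * pencil es vs t ∎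
            where
            columns : combine (t - a) w 0# w ≋ combine (k * coefficient) (g vector) 1# y
            columns i = begin
              (t - a) * w i + 0# * w i
                ≈⟨ solve 3 (λ t a w → (t :- a) :* w :+ con (ℤ.+ 0) :* w := t :* w :- a :* w) refl t a (w i) ⟩
              t * w i - a * w i
                ≈⟨ +-congˡ (-‿cong (eigen i)) ⟨
              g w i
                ≈⟨ shift-w t i ⟩
              k * (coefficient * g vector i + - 1# * g u i) + g s i
                ≈⟨ solve 5 (λ k c e u s →
                     k :* (c :* e :+ (:- con (ℤ.+ 1)) :* u) :+ s :=
                     k :* c :* e :+ con (ℤ.+ 1) :* ((:- k) :* u :+ con (ℤ.+ 1) :* s))
                   refl k coefficient (g vector i) (g u i) (g s i) ⟩
              combine (k * coefficient) (g vector) 1# y i ∎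

        difference : ∀ t → (t - a) * (α′ * new t + - β′ * monicProduct as t) ≈ 0#
        difference t = begin
          (t - a) * (α′ * new t + - β′ * monicProduct as t)
            ≈⟨ solve 6 (λ q α σ d β π → q :* (α :* σ :* d :+ (:- β) :* π) := q :* α :* (σ :* d) :- β :* (q :* π))
                 refl (t - a) α σ₂ (new t) β′ (monicProduct as t) ⟩
          (t - a) * α * (σ₂ * new t) - β′ * ((t - a) * monicProduct as t)
            ≈⟨ +-congʳ (*-congˡ (move-X t)) ⟨
          (t - a) * α * (σ₁ * X t) - β′ * ((t - a) * monicProduct as t)
            ≈⟨ +-congʳ (solve 4 (λ q α σ x → q :* α :* (σ :* x) := σ :* α :* (q :* x)) refl (t - a) α σ₁ (X t)) ⟩
          σ₁ * α * ((t - a) * X t) - β′ * ((t - a) * monicProduct as t)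
            ≈⟨ +-congʳ (*-congˡ (expand-X t)) ⟩
          σ₁ * α * (k * coefficient * pencil es vs t) - β′ * ((t - a) * monicProduct as t)
            ≈⟨ solve 6 (λ σ α c d β π → σ :* α :* (c :* d) :- σ :* c :* β :* π := σ :* c :* (α :* d :- β :* π))
                 refl σ₁ α (k * coefficient) (pencil es vs t) β ((t - a) * monicProduct as t) ⟩
          σ₁ * (k * coefficient) * (α * pencil es vs t - β * ((t - a) * monicProduct as t))
            ≈⟨ *-congˡ (trans (+-congʳ (factored t)) (-‿inverseʳ _)) ⟩
          σ₁ * (k * coefficient) * 0#
            ≈⟨ zeroʳ _ ⟩
          0# ∎

      factored′ : ∀ t → α′ * new t ≈ β′ * monicProduct as t
      -- Both sides are raised to the common degree bound `length as + suc m`, so that `t - a` can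
      -- be cancelled from their difference.
      factored′ t = x-y≈0⇒x≈y (polynomial-cancel (length as ℕ.+ suc m) a
        (polynomial-combine (length as ℕ.+ suc m) α′ (- β′)
          (polynomial-raise (length as) (suc m) (polynomial-pencil remaining ((a , w) ∷ vs)))
          (≡.subst (λ n → Polynomial n (monicProduct as))
            (≡.trans (ℕ.+-suc m (length as))
              (≡.trans (≡.cong suc (ℕ.+-comm m (length as))) (≡.sym (ℕ.+-suc (length as) m))))
            (polynomial-raise m (suc (length as)) (polynomial-monicProduct as))))
        difference t)
        where
        x-y≈0⇒x≈y : ∀ {x b y} → x + - b * y ≈ 0# → x ≈ b * y
        x-y≈0⇒x≈y {x} {b} {y} eq = trans
          (solve 3 (λ x b y → x := (x :+ (:- b) :* y) :+ b :* y) refl x b y)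
          (trans (+-congʳ eq) (+-identityˡ _))

      extended : OrthogonalEigenpairs ((a , w) ∷ vs)
      extended = cons eigen w≉0 w⊥ o
        where
        -- If `w` vanished, the new determinant would vanish for every `t`, and by `factored′` so
        -- would the monic product of the remaining factors.
        w≉0 : ¬ ⟨ w , w ⟩ ≈ 0#
        w≉0 eq = ⟨⟩-definite w eq λ w≋0 → monicProduct-nonzero as λ t →
          integral (trans (sym (factored′ t)) (trans (*-assoc α σ₂ (new t)) (trans
            (*-congˡ (trans (move-new t) (alternating-zero alt w _ w≋0))) (zeroʳ α)))) β′≉0

      length-remaining : suc (length remaining) ≡ length es
      length-remaining = ≡.trans (≡.sym (List.length-++-sucʳ before vector after)) (≡.cong length (≡.sym split))

  -- The values in `bs` are consumed, those in `as` only carried as factors. A step keeps the number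
  -- of columns, so the factor `b - b` at `t = b` always gives a dependence, and distinctness of the
  -- eigenvalues never enters.
  eigenpairs : ∀ {q vs es as α β} (Q : Pred Carrier q) bs → OrthogonalEigenpairs vs → All Q bs →
    All (Q ∘ proj₁) vs → m ℕ.≤ length es ℕ.+ length vs → ¬ α ≈ 0# → ¬ β ≈ 0# →
    (∀ t → α * pencil es vs t ≈ β * monicProduct (bs ++ as) t) →
    ¬ ¬ (∃[ vs′ ] OrthogonalEigenpairs vs′ × All (Q ∘ proj₁) vs′ × length vs′ ≡ length bs ℕ.+ length vs)
  eigenpairs {vs = vs} Q [] o [] qs m≤ α≉0 β≉0 factored k = k (vs , o , qs , ≡.refl)
  eigenpairs {vs = vs} {es} {as} {α} {β} Q (b ∷ bs) o (q ∷ qs′) qs m≤ α≉0 β≉0 factored k =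
    det≈0⇒dependent m columns (≡.subst (m ℕ.≤_) (≡.sym length-columns) m≤) singular λ dep →
    let rel = relation (shift A b) es (orthogonal⇒independent o) dep
        open Deflation o {as = bs ++ as} α≉0 β≉0 factored rel
    in shift-eigenvector λ eq →
       eigenpairs {as = as} Q bs (extended eq) qs′ (q ∷ qs)
         (≡.subst (m ℕ.≤_) (≡.trans (≡.cong (ℕ._+ length vs) (≡.sym (length-remaining eq))) (≡.sym (ℕ.+-suc _ _))) m≤)
         (α′≉0 eq) (β′≉0 eq) (factored′ eq)
         λ (vs′ , o′ , qs″ , len) → k (vs′ , o′ , qs″ , ≡.trans len (ℕ.+-suc (length bs) (length vs)))
    where
    columns = map (shift A b) es ++ vectors vs
    length-columns : length columns ≡ length es ℕ.+ length vs
    length-columns = ≡.trans (List.length-++ (map (shift A b) es))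
      (≡.cong₂ ℕ._+_ (List.length-map (shift A b) es) (List.length-map proj₂ vs))
    singular : detCols m columns ≈ 0#
    singular = integral (begin
      α * pencil es vs b                                   ≈⟨ factored b ⟩
      β * ((b - b) * monicProduct (bs ++ as) b)            ≈⟨ *-congˡ (*-congʳ (-‿inverseʳ b)) ⟩
      β * (0# * monicProduct (bs ++ as) b)                 ≈⟨ trans (*-congˡ (zeroˡ _)) (zeroʳ β) ⟩
      0#                                                   ∎) α≉0

-- Counting eigenvalues above a bound on row sums

module EigenvalueBound {c ℓ p} {R : RawRing c ℓ} (D : OrderedDomain R p) {m}
  (A : Matrix (RawRing.Carrier R) m) (A-symmetric : ∀ i j → RawRing._≈_ R (A i j) (A j i)) where
  open OrderedDomain D
  open IntegerSolver commutativeRing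
  open Determinants commutativeRing
  open Alternating
  open LinearDependence D
  open Polynomials D
  open InnerProduct D
  open Eigenvectors D A A-symmetric
  open Algebra.Properties.Ring ring
  open Algebra.Properties.Semiring.Sum semiring using (sum; sum-cong-≋; *-distribˡ-sum; *-distribʳ-sum; ∑-comm)
  open Relation.Binary.Reasoning.Setoid setoid

  private
    V = Vector Carrier m

  unit : ∀ {n} → Fin n → Vector Carrier n
  unit j i = if does (i Fin.≟ j) then 1# else 0#

  ⟨⟩-unit : ∀ {n} (x : Vector Carrier n) j → ⟨ x , unit j ⟩ ≈ x j
  ⟨⟩-unit x zero    = trans (+-cong (*-identityʳ _) (⟨⟩-zeroʳ (x ∘ suc) λ _ → refl)) (+-identityʳ _)
  ⟨⟩-unit x (suc j) = trans (+-cong (zeroʳ _) (⟨⟩-unit (x ∘ suc) j)) (+-identityˡ _)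

  -- The starting point of the deflation: no eigenvectors yet, and the standard basis as the vectors
  -- to be replaced.
  charPoly-pencil : ∀ t → charPoly R A t ≈ pencil (tabulate unit) [] t
  charPoly-pencil t = begin
    charPoly R A t
      ≈⟨ det-detCols (λ i j → (if does (i Fin.≟ j) then t else 0#) + - A i j) ⟩
    detCols m (tabulate λ j i → (if does (i Fin.≟ j) then t else 0#) + - A i j)
      ≈⟨ cong (detCols-alternating m) (Pointwise.tabulate⁺ column) ⟩
    detCols m (tabulate (shift A t ∘ unit))
      ≡⟨ ≡.cong (detCols m) (≡.trans (≡.sym (List.map-tabulate unit (shift A t))) (≡.sym (List.++-identityʳ _))) ⟩
    pencil (tabulate unit) [] t ∎
    where
    column : ∀ j i → (if does (i Fin.≟ j) then t else 0#) + - A i j ≈ shift A t (unit j) i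
    column j i = +-cong entry (-‿cong (sym (⟨⟩-unit (A i) j)))
      where
      entry : (if does (i Fin.≟ j) then t else 0#) ≈ t * unit j i
      entry with does (i Fin.≟ j)
      ... | true  = sym (*-identityʳ t)
      ... | false = sym (zeroʳ t)

  module _ (d : Carrier) where

    energy : V → Carrier
    energy x = ⟨ x , apply A x ⟩ - d * ⟨ x , x ⟩

    energy-cong : ∀ {x y} → x ≋ y → energy x ≈ energy y
    energy-cong x≋y = +-cong (⟨⟩-cong x≋y (apply-cong A x≋y)) (-‿cong (*-congˡ (⟨⟩-cong x≋y x≋y)))

    ⟨⟩-combine : ∀ a (v v′ : V) b y y′ → ⟨ combine a v b y , combine a v′ b y′ ⟩ ≈
      a * (a * ⟨ v , v′ ⟩ + b * ⟨ v , y′ ⟩) + b * (a * ⟨ y , v′ ⟩ + b * ⟨ y , y′ ⟩)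
    ⟨⟩-combine a v v′ b y y′ = trans (⟨⟩-combineˡ a v b y _)
      (+-cong (*-congˡ (⟨⟩-combineʳ v a v′ b y′)) (*-congˡ (⟨⟩-combineʳ y a v′ b y′)))

    -- The cross terms vanish because both `⟨ v , y ⟩` and `⟨ v , A y ⟩ = r ⟨ v , y ⟩` do.
    energy-combine : ∀ {r v y} a → apply A v ≋ r · v → ⟨ v , y ⟩ ≈ 0# →
      energy (combine a v 1# y) ≈ (r - d) * (a * a * ⟨ v , v ⟩) + energy y
    energy-combine {r} {v} {y} a eigen v⊥y = begin
      energy (combine a v 1# y)
        ≈⟨ +-cong (trans (⟨⟩-cong {x = combine a v 1# y} (λ _ → refl) (apply-combine A a v 1# y))
                         (⟨⟩-combine a v (apply A v) 1# y (apply A y)))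
                  (-‿cong (*-congˡ (⟨⟩-combine a v v 1# y y))) ⟩
      a * (a * ⟨ v , apply A v ⟩ + 1# * ⟨ v , apply A y ⟩) + 1# * (a * ⟨ y , apply A v ⟩ + 1# * ⟨ y , apply A y ⟩)
        - d * (a * (a * ⟨ v , v ⟩ + 1# * ⟨ v , y ⟩) + 1# * (a * ⟨ y , v ⟩ + 1# * ⟨ y , y ⟩))
        ≈⟨ +-cong
             (+-cong (*-congˡ (+-cong (*-congˡ vAv) (*-congˡ vAy))) (*-congˡ (+-congʳ (*-congˡ yAv))))
             (-‿cong (*-congˡ (+-cong (*-congˡ (+-congˡ (*-congˡ v⊥y))) (*-congˡ (+-congʳ (*-congˡ y⊥v)))))) ⟩
      a * (a * (r * ⟨ v , v ⟩) + 1# * 0#) + 1# * (a * 0# + 1# * ⟨ y , apply A y ⟩)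
        - d * (a * (a * ⟨ v , v ⟩ + 1# * 0#) + 1# * (a * 0# + 1# * ⟨ y , y ⟩))
        ≈⟨ solve 6 (λ a r d q u w →
             a :* (a :* (r :* q) :+ con (ℤ.+ 1) :* con (ℤ.+ 0)) :+ con (ℤ.+ 1) :* (a :* con (ℤ.+ 0) :+ con (ℤ.+ 1) :* u)
             :- d :* (a :* (a :* q :+ con (ℤ.+ 1) :* con (ℤ.+ 0)) :+ con (ℤ.+ 1) :* (a :* con (ℤ.+ 0) :+ con (ℤ.+ 1) :* w))
             := (r :- d) :* (a :* a :* q) :+ (u :- d :* w))
             refl a r d ⟨ v , v ⟩ ⟨ y , apply A y ⟩ ⟨ y , y ⟩ ⟩
      (r - d) * (a * a * ⟨ v , v ⟩) + energy y ∎
      where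
      y⊥v : ⟨ y , v ⟩ ≈ 0#
      y⊥v = trans (⟨⟩-comm y v) v⊥y
      vAv : ⟨ v , apply A v ⟩ ≈ r * ⟨ v , v ⟩
      vAv = trans (⟨⟩-cong {x = v} (λ _ → refl) eigen) (⟨⟩-scaleʳ v r v)
      yAv : ⟨ y , apply A v ⟩ ≈ 0#
      yAv = trans (⟨⟩-cong {x = y} (λ _ → refl) eigen)
              (trans (⟨⟩-scaleʳ y r v) (trans (*-congˡ y⊥v) (zeroʳ r)))
      vAy : ⟨ v , apply A y ⟩ ≈ 0#
      vAy = trans (sym (apply-symmetric A A-symmetric v y)) (trans (⟨⟩-comm (apply A v) y) yAv)

    Above : Pred Carrier _
    Above r = NonNeg (r - d) × ¬ r - d ≈ 0#

    energy-nonNeg : ∀ {vs u} → OrthogonalEigenpairs vs → All (Above ∘ proj₁) vs →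
      Span (vectors vs) u → NonNeg (energy u)
    energy-nonNeg {u = u} [] [] (nil u≋0) = nonNeg-resp (sym (begin
      energy u               ≈⟨ +-cong (trans (⟨⟩-comm u (apply A u)) (⟨⟩-zeroʳ _ u≋0)) (-‿cong (*-congˡ (⟨⟩-zeroʳ u u≋0))) ⟩
      0# - d * 0#            ≈⟨ solve 1 (λ d → con (ℤ.+ 0) :- d :* con (ℤ.+ 0) := con (ℤ.+ 0) :* con (ℤ.+ 0)) refl d ⟩
      0# * 0#                ∎)) (nonNeg-square 0#)
    energy-nonNeg (cons {v = v} eigen v≉0 v⊥vs o) ((r≥d , _) ∷ qs) (cons a y eq s) = nonNeg-resp
      (sym (trans (energy-cong (λ i → trans (eq i) (+-congˡ (sym (*-identityˡ (y i))))))
                  (energy-combine a eigen (⟨⟩-span v⊥vs s))))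
      (nonNeg-+ (nonNeg-* r≥d (nonNeg-* (nonNeg-square a) (⟨⟩-nonNeg v))) (energy-nonNeg o qs s))

    private
      span-restrict : ∀ {k} (S : Fin k → Fin m) xs {y} → Span (map (_∘ S) xs) y →
        ∃[ u ] Span xs u × u ∘ S ≋ y
      span-restrict S []       (nil y≋0) = 0ᵛ , nil (λ _ → refl) , λ i → sym (y≋0 i)
      span-restrict S (x ∷ xs) (cons a y eq s) =
        let (u , u∈ , u≋y) = span-restrict S xs s in
        combine a x 1# u , cons a u (λ i → +-congˡ (*-identityˡ (u i))) u∈ ,
        λ i → trans (+-congˡ (trans (*-identityˡ _) (u≋y i))) (sym (eq i))

    -- The dependence on `S` reads `b v = u` there, so `b v - u` vanishes on `S`. Its leading part
    -- has energy `(r - d) b² ⟨ v , v ⟩`, which is nonzero, and the rest cannot cancel it.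
    positive-vanishing : ∀ {k} (S : Fin k → Fin m) {vs} → OrthogonalEigenpairs vs → All (Above ∘ proj₁) vs →
      Dependent (map (_∘ S) (vectors vs)) →
      ∃[ x ] NonNeg (energy x) × ¬ energy x ≈ 0# × x ∘ S ≋ 0ᵛ
    positive-vanishing S {(r , v) ∷ vs} (cons eigen v≉0 v⊥vs o) ((r≥d , r≉d) ∷ qs) (here {b = b} b≉0 s) =
      let (u , u∈ , u≋bv) = span-restrict S (vectors vs) s
          y = (- 1#) · u
          y∈ = span-scale (- 1#) u∈
          eq = energy-combine b eigen (⟨⟩-span v⊥vs y∈)
          leading≥0 = nonNeg-* r≥d (nonNeg-* (nonNeg-square b) (⟨⟩-nonNeg v))
          rest≥0 = energy-nonNeg o qs y∈
      in combine b v 1# y , nonNeg-resp (sym eq) (nonNeg-+ leading≥0 rest≥0) ,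
         (λ eq0 → *-nonzero r≉d (*-nonzero (*-nonzero b≉0 b≉0) v≉0)
           (nonNeg-antisym leading≥0 rest≥0 (trans (sym eq) eq0))) ,
         λ i → trans (+-congˡ (*-congˡ (*-congˡ (u≋bv i))))
           (solve 1 (λ x → x :+ con (ℤ.+ 1) :* ((:- con (ℤ.+ 1)) :* x) := con (ℤ.+ 0)) refl (b * v (S i)))
    positive-vanishing S (cons _ _ _ o) (_ ∷ qs) (there dep) = positive-vanishing S o qs dep

    module _ (W : Matrix Carrier m) (W-nonNeg : ∀ i j → NonNeg (W i j)) (W-symmetric : ∀ i j → W i j ≈ W j i)
      (A≈±W : ∀ i j → A i j ≈ W i j ⊎ A i j ≈ - W i j) where

      private
        2# : Carrier
        2# = 1# + 1#

      -- 2 (Σ Wᵢⱼ xᵢ² - Σ Aᵢⱼ xᵢ xⱼ) = Σ Wᵢⱼ (xᵢ ± xⱼ)²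
      energy-nonPos : ∀ x → (∀ i → x i ≈ 0# ⊎ NonNeg (d - sum (W i))) →
        ∃[ y ] NonNeg y × energy x + (energy x + y) ≈ 0#
      energy-nonPos x small = squares + 2# * rest ,
        nonNeg-+ (sum-nonNeg _ λ i → sum-nonNeg _ λ j → square-nonNeg i j)
                 (nonNeg-* (nonNeg-+ nonNeg-1 nonNeg-1) (sum-nonNeg _ rest-nonNeg)) , (begin
        energy x + (energy x + (squares + 2# * rest))
          ≈⟨ +-congˡ (+-congˡ (+-cong squares-sum (*-congˡ rest-sum))) ⟩
        energy x + (energy x + ((degrees + (degrees + - 2# * ⟨ x , apply A x ⟩)) + 2# * (d * ⟨ x , x ⟩ - degrees)))
          ≈⟨ solve 4 (λ a d q w →
               let e = a :- d :* q ; 2′ = con (ℤ.+ 1) :+ con (ℤ.+ 1) in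
               e :+ (e :+ ((w :+ (w :+ (:- 2′) :* a)) :+ 2′ :* (d :* q :- w))) := con (ℤ.+ 0))
               refl ⟨ x , apply A x ⟩ d ⟨ x , x ⟩ degrees ⟩
        0# ∎)
        where
        square : Matrix Carrier m
        square i j = W i j * (x i * x i) + (W i j * (x j * x j) + - 2# * (x i * (A i j * x j)))

        square-nonNeg : ∀ i j → NonNeg (square i j)
        square-nonNeg i j with A≈±W i j
        ... | inj₁ A≈W = nonNeg-resp
          (trans (solve 3 (λ w x y → w :* ((x :- y) :* (x :- y)) :=
                    w :* (x :* x) :+ (w :* (y :* y) :+ (:- (con (ℤ.+ 1) :+ con (ℤ.+ 1))) :* (x :* (w :* y))))
                    refl (W i j) (x i) (x j))
            (+-congˡ (+-congˡ (*-congˡ (*-congˡ (*-congʳ (sym A≈W)))))))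
          (nonNeg-* (W-nonNeg i j) (nonNeg-square (x i - x j)))
        ... | inj₂ A≈-W = nonNeg-resp
          (trans (solve 3 (λ w x y → w :* ((x :+ y) :* (x :+ y)) :=
                    w :* (x :* x) :+ (w :* (y :* y) :+ (:- (con (ℤ.+ 1) :+ con (ℤ.+ 1))) :* (x :* ((:- w) :* y))))
                    refl (W i j) (x i) (x j))
            (+-congˡ (+-congˡ (*-congˡ (*-congˡ (*-congʳ (sym A≈-W)))))))
          (nonNeg-* (W-nonNeg i j) (nonNeg-square (x i + x j)))

        squares rest degrees : Carrier
        squares = sum λ i → sum (square i)
        rest    = sum λ i → (d - sum (W i)) * (x i * x i)
        degrees = sum λ i → sum (W i) * (x i * x i)

        rest-nonNeg : ∀ i → NonNeg ((d - sum (W i)) * (x i * x i))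
        rest-nonNeg i with small i
        ... | inj₁ xᵢ≈0 = nonNeg-resp
          (sym (trans (*-congˡ (*-congˡ xᵢ≈0))
            (solve 2 (λ e x → e :* (x :* con (ℤ.+ 0)) := con (ℤ.+ 0) :* con (ℤ.+ 0)) refl _ (x i))))
          (nonNeg-square 0#)
        ... | inj₂ d≥ = nonNeg-* d≥ (nonNeg-square (x i))

        rest-sum : rest ≈ d * ⟨ x , x ⟩ - degrees
        rest-sum = begin
          rest
            ≈⟨ sum-cong-≋ {m} (λ i → solve 3 (λ d w q → (d :- w) :* q := d :* q :+ (:- con (ℤ.+ 1)) :* (w :* q))
                 refl d (sum (W i)) (x i * x i)) ⟩
          sum (λ i → d * (x i * x i) + - 1# * (sum (W i) * (x i * x i)))
            ≈⟨ sum-combine d (λ i → x i * x i) (- 1#) (λ i → sum (W i) * (x i * x i)) ⟩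
          d * ⟨ x , x ⟩ + - 1# * degrees
            ≈⟨ +-congˡ (-1*x≈-x degrees) ⟩
          d * ⟨ x , x ⟩ - degrees ∎

        sum-combine₃ : ∀ {n} b (f g h : Vector Carrier n) →
          sum (λ i → f i + (g i + b * h i)) ≈ sum f + (sum g + b * sum h)
        sum-combine₃ b f g h = begin
          sum (λ i → f i + (g i + b * h i))
            ≈⟨ sum-cong-≋ (λ i → sym (+-cong (*-identityˡ (f i)) (trans (*-identityˡ _) (+-congʳ (*-identityˡ (g i)))))) ⟩
          sum (λ i → 1# * f i + 1# * (1# * g i + b * h i))
            ≈⟨ sum-combine 1# f 1# (λ i → 1# * g i + b * h i) ⟩
          1# * sum f + 1# * sum (λ i → 1# * g i + b * h i)
            ≈⟨ +-cong (*-identityˡ _) (trans (*-identityˡ _)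
                 (trans (sum-combine 1# g b h) (+-congʳ (*-identityˡ _)))) ⟩
          sum f + (sum g + b * sum h) ∎

        -- Column sums of `W` equal its row sums, so both squared terms contribute the same total.
        transposed : sum (λ i → sum λ j → W i j * (x j * x j)) ≈ degrees
        transposed = begin
          sum (λ i → sum λ j → W i j * (x j * x j))
            ≈⟨ ∑-comm (λ i j → W i j * (x j * x j)) ⟩
          sum (λ j → sum λ i → W i j * (x j * x j))
            ≈⟨ sum-cong-≋ (λ j → trans (sum-cong-≋ λ i → *-congʳ (W-symmetric i j)) (sym (*-distribʳ-sum (x j * x j) (W j)))) ⟩
          degrees ∎

        squares-sum : squares ≈ degrees + (degrees + - 2# * ⟨ x , apply A x ⟩)
        squares-sum = begin
          squares
            ≈⟨ sum-cong-≋ (λ i → trans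
                 (sum-combine₃ (- 2#) (λ j → W i j * (x i * x i)) (λ j → W i j * (x j * x j)) (λ j → x i * (A i j * x j)))
                 (+-cong (sym (*-distribʳ-sum (x i * x i) (W i)))
                         (+-congˡ (*-congˡ (sym (*-distribˡ-sum (x i) (λ j → A i j * x j))))))) ⟩
          sum (λ i → sum (W i) * (x i * x i) + (sum (λ j → W i j * (x j * x j)) + - 2# * (x i * apply A x i)))
            ≈⟨ sum-combine₃ (- 2#) (λ i → sum (W i) * (x i * x i))
                 (λ i → sum λ j → W i j * (x j * x j)) (λ i → x i * apply A x i) ⟩
          degrees + (sum (λ i → sum λ j → W i j * (x j * x j)) + - 2# * ⟨ x , apply A x ⟩)
            ≈⟨ +-congˡ (+-congʳ transposed) ⟩
          degrees + (degrees + - 2# * ⟨ x , apply A x ⟩) ∎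

      few-eigenvalues-above : ∀ {k} (S : Fin k → Fin m) →
        (∀ i → (∃[ s ] S s ≡ i) ⊎ NonNeg (d - sum (W i))) →
        ∀ bs as → All Above bs → (∀ t → charPoly R A t ≈ monicProduct (bs ++ as) t) →
        ¬ k ℕ.< length bs
      few-eigenvalues-above {k} S small bs as above factored k< =
        eigenpairs {as = as} Above bs [] above []
          (ℕ.≤-reflexive (≡.sym (≡.trans (ℕ.+-identityʳ _) (List.length-tabulate unit)))) 1≉0 1≉0
          (λ t → *-congˡ (trans (sym (charPoly-pencil t)) (factored t)))
          λ (vs , o , qs , len) →
            let columns = map (_∘ S) (vectors vs)
                wide : k ℕ.< length columns
                wide = ≡.subst (k ℕ.<_) (≡.sym (≡.trans (List.length-map _ (vectors vs)) (≡.trans (List.length-map proj₂ vs)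
                         (≡.trans len (ℕ.+-identityʳ _))))) k<
            in det≈0⇒dependent k columns (ℕ.<⇒≤ wide) (detCols-wide k columns wide) λ dep →
               let (x , E≥0 , E≉0 , x∘S≋0) = positive-vanishing S o qs dep
                   (y , y≥0 , eq) = energy-nonPos x λ i → vanishing x x∘S≋0 i (small i)
               -- The energy occurs twice because the sum of squares bounds its double; antisymmetry
               -- applies to this form without halving.
               in E≉0 (nonNeg-antisym E≥0 (nonNeg-+ E≥0 y≥0) eq)
        where
        vanishing : ∀ x → x ∘ S ≋ 0ᵛ → ∀ i → (∃[ s ] S s ≡ i) ⊎ NonNeg (d - sum (W i)) →
          x i ≈ 0# ⊎ NonNeg (d - sum (W i))
        vanishing x x∘S≋0 i (inj₁ (s , ≡.refl)) = inj₁ (x∘S≋0 s)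
        vanishing x x∘S≋0 i (inj₂ d≥)           = inj₂ d≥

-- Cauchy reals as an ordered domain

module RealNumbers where
  open ≡
  open +-*-Solver

  halve : ∀ {ε} → 0ℚ ℚ.< ε → 0ℚ ℚ.< ½ ℚ.* ε
  halve {ε} 0<ε = ℚ.positive⁻¹ _ {{ℚ.pos*pos⇒pos ½ ε {{ℚ.positive 0<ε}}}}

  halves : ∀ ε → ½ ℚ.* ε ℚ.+ ½ ℚ.* ε ≡ ε
  halves ε = trans (sym (ℚ.*-distribʳ-+ ε ½ ½)) (ℚ.*-identityˡ ε)

  *-pos : ∀ {p q} → 0ℚ ℚ.< p → 0ℚ ℚ.< q → 0ℚ ℚ.< p ℚ.* q
  *-pos {p} {q} 0<p 0<q = ℚ.positive⁻¹ _ {{ℚ.pos*pos⇒pos p {{ℚ.positive 0<p}} q {{ℚ.positive 0<q}}}}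

  -- `x ≃ y` unfolds to `Null` of the termwise difference, so the congruence laws reduce to closure
  -- properties of null sequences.
  Null : (ℕ → ℚ) → Set
  Null s = ∀ ε → 0ℚ ℚ.< ε → ∃[ N ] ∀ n → N ℕ.≤ n → ℚ.∣ s n ∣ ℚ.≤ ε

  Bounded : (ℕ → ℚ) → Set
  Bounded s = ∃[ B ] (0ℚ ℚ.< B × ∃[ N ] ∀ n → N ℕ.≤ n → ℚ.∣ s n ∣ ℚ.≤ B)

  null-resp : ∀ {s t} → (∀ n → s n ≡ t n) → Null s → Null t
  null-resp s≡t null ε 0<ε = let (N , p) = null ε 0<ε in
    N , λ n N≤n → subst (λ q → ℚ.∣ q ∣ ℚ.≤ ε) (s≡t n) (p n N≤n)

  null-0 : ∀ {s} → (∀ n → s n ≡ 0ℚ) → Null s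
  null-0 s≡0 ε 0<ε = 0 , λ n _ → subst (λ q → ℚ.∣ q ∣ ℚ.≤ ε) (sym (s≡0 n)) (ℚ.<⇒≤ 0<ε)

  null-+ : ∀ {s t} → Null s → Null t → Null (λ n → s n ℚ.+ t n)
  null-+ {s} {t} ns nt ε 0<ε =
    let (M , p) = ns (½ ℚ.* ε) (halve 0<ε)
        (N , q) = nt (½ ℚ.* ε) (halve 0<ε)
    in M ℕ.⊔ N , λ n ≤n → begin
      ℚ.∣ s n ℚ.+ t n ∣            ≤⟨ ℚ.∣p+q∣≤∣p∣+∣q∣ (s n) (t n) ⟩
      ℚ.∣ s n ∣ ℚ.+ ℚ.∣ t n ∣      ≤⟨ ℚ.+-mono-≤ (p n (ℕ.m⊔n≤o⇒m≤o M N ≤n)) (q n (ℕ.m⊔n≤o⇒n≤o M N ≤n)) ⟩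
      ½ ℚ.* ε ℚ.+ ½ ℚ.* ε          ≡⟨ halves ε ⟩
      ε                            ∎
    where open ℚ.≤-Reasoning

  null-neg : ∀ {s} → Null s → Null (λ n → ℚ.- s n)
  null-neg {s} ns ε 0<ε = let (N , p) = ns ε 0<ε in
    N , λ n N≤n → subst (ℚ._≤ ε) (sym (ℚ.∣-p∣≡∣p∣ (s n))) (p n N≤n)

  null-* : ∀ {s t} → Null s → Bounded t → Null (λ n → s n ℚ.* t n)
  null-* {s} {t} ns (B , 0<B , M , bound) ε 0<ε =
    let (N , p) = ns (ℚ.1/ B ℚ.* ε) (*-pos {ℚ.1/ B} (ℚ.positive⁻¹ _ {{ℚ.1/pos⇒pos B}}) 0<ε)
    in M ℕ.⊔ N , λ n ≤n → begin
      ℚ.∣ s n ℚ.* t n ∣          ≡⟨ ℚ.∣p*q∣≡∣p∣*∣q∣ (s n) (t n) ⟩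
      ℚ.∣ s n ∣ ℚ.* ℚ.∣ t n ∣    ≤⟨ ℚ.*-monoˡ-≤-nonNeg ℚ.∣ s n ∣ {{ℚ.nonNegative (ℚ.0≤∣p∣ (s n))}}
                                         (bound n (ℕ.m⊔n≤o⇒m≤o M N ≤n)) ⟩
      ℚ.∣ s n ∣ ℚ.* B            ≤⟨ ℚ.*-monoʳ-≤-nonNeg B {{ℚ.pos⇒nonNeg B}} (p n (ℕ.m⊔n≤o⇒n≤o M N ≤n)) ⟩
      ℚ.1/ B ℚ.* ε ℚ.* B         ≡⟨ solve 3 (λ b ε B → b :* ε :* B := (b :* B) :* ε) refl (ℚ.1/ B) ε B ⟩
      (ℚ.1/ B ℚ.* B) ℚ.* ε       ≡⟨ cong (ℚ._* ε) (ℚ.*-inverseˡ B) ⟩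
      1ℚ ℚ.* ε                   ≡⟨ ℚ.*-identityˡ ε ⟩
      ε                          ∎
    where
    open ℚ.≤-Reasoning
    instance
      B-positive : ℚ.Positive B
      B-positive = ℚ.positive 0<B
      B-nonZero : ℚ.NonZero B
      B-nonZero = ℚ.pos⇒nonZero B

  bounded : ∀ x → Bounded (seq x)
  bounded x = let (N , p) = cauchy x 1ℚ (ℚ.positive⁻¹ 1ℚ) in
    1ℚ ℚ.+ ℚ.∣ seq x N ∣ ,
    ℚ.+-mono-<-≤ (ℚ.positive⁻¹ 1ℚ) (ℚ.0≤∣p∣ (seq x N)) ,
    N , λ n N≤n → begin
      ℚ.∣ seq x n ∣
        ≡⟨ cong ℚ.∣_∣ (solve 2 (λ a b → a := (a :- b) :+ b) refl (seq x n) (seq x N)) ⟩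
      ℚ.∣ (seq x n ℚ.- seq x N) ℚ.+ seq x N ∣
        ≤⟨ ℚ.∣p+q∣≤∣p∣+∣q∣ (seq x n ℚ.- seq x N) (seq x N) ⟩
      ℚ.∣ seq x n ℚ.- seq x N ∣ ℚ.+ ℚ.∣ seq x N ∣
        ≤⟨ ℚ.+-monoˡ-≤ ℚ.∣ seq x N ∣ (p n N N≤n ℕ.≤-refl) ⟩
      1ℚ ℚ.+ ℚ.∣ seq x N ∣ ∎
    where open ℚ.≤-Reasoning

  pointwise : ∀ {x y} → (∀ n → seq x n ≡ seq y n) → x ≃ y
  pointwise {x} {y} eq = null-0 λ n → trans (cong (ℚ._- seq y n) (eq n)) (ℚ.+-inverseʳ (seq y n))

  ≃-sym : ∀ {x y} → x ≃ y → y ≃ x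
  ≃-sym {x} {y} p = null-resp
    (λ n → solve 2 (λ x y → :- (x :- y) := y :- x) refl (seq x n) (seq y n))
    (null-neg p)

  ≃-trans : ∀ {x y z} → x ≃ y → y ≃ z → x ≃ z
  ≃-trans {x} {y} {z} p q = null-resp
    (λ n → solve 3 (λ x y z → (x :- y) :+ (y :- z) := x :- z) refl (seq x n) (seq y n) (seq z n))
    (null-+ p q)

  +ᴿ-cong : ∀ {x x′ y y′} → x ≃ x′ → y ≃ y′ → x +ᴿ y ≃ x′ +ᴿ y′
  +ᴿ-cong {x} {x′} {y} {y′} p q = null-resp
    (λ n → solve 4 (λ x x′ y y′ → (x :- x′) :+ (y :- y′) := (x :+ y) :- (x′ :+ y′)) refl
      (seq x n) (seq x′ n) (seq y n) (seq y′ n))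
    (null-+ p q)

  *ᴿ-cong : ∀ {x x′ y y′} → x ≃ x′ → y ≃ y′ → x *ᴿ y ≃ x′ *ᴿ y′
  *ᴿ-cong {x} {x′} {y} {y′} p q = null-resp
    (λ n → solve 4 (λ x x′ y y′ → (x :- x′) :* y :+ (y :- y′) :* x′ := x :* y :- x′ :* y′) refl
      (seq x n) (seq x′ n) (seq y n) (seq y′ n))
    (null-+ (null-* p (bounded y)) (null-* q (bounded x′)))

  -ᴿ-cong : ∀ {x y} → x ≃ y → -ᴿ x ≃ -ᴿ y
  -ᴿ-cong {x} {y} p = null-resp
    (λ n → solve 2 (λ x y → :- (x :- y) := (:- x) :- (:- y)) refl (seq x n) (seq y n))
    (null-neg p)

  ℝ-commutativeRing : CommutativeRing 0ℓ 0ℓ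
  ℝ-commutativeRing = record
    { Carrier = ℝ
    ; _≈_     = _≃_
    ; _+_     = _+ᴿ_
    ; _*_     = _*ᴿ_
    ; -_      = -ᴿ_
    ; 0#      = fromℚ 0ℚ
    ; 1#      = fromℚ 1ℚ
    ; isCommutativeRing = record
      { isRing = record
        { +-isAbelianGroup = record
          { isGroup = record
            { isMonoid = record
              { isSemigroup = record
                { isMagma = record
                  { isEquivalence = record
                    { refl  = λ {x} → pointwise {x} {x} λ _ → refl
                    ; sym   = λ {x} {y} → ≃-sym {x} {y}
                    ; trans = λ {x} {y} {z} → ≃-trans {x} {y} {z}
                    }
                  ; ∙-cong = λ {x} {x′} {y} {y′} → +ᴿ-cong {x} {x′} {y} {y′}
                  }
                ; assoc = λ x y z → pointwise {x +ᴿ y +ᴿ z} {x +ᴿ (y +ᴿ z)}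
                    λ n → ℚ.+-assoc (seq x n) (seq y n) (seq z n)
                }
              ; identity = (λ x → pointwise {fromℚ 0ℚ +ᴿ x} {x} λ n → ℚ.+-identityˡ (seq x n)) ,
                           (λ x → pointwise {x +ᴿ fromℚ 0ℚ} {x} λ n → ℚ.+-identityʳ (seq x n))
              }
            ; inverse = (λ x → pointwise { -ᴿ x +ᴿ x} {fromℚ 0ℚ} λ n → ℚ.+-inverseˡ (seq x n)) ,
                        (λ x → pointwise {x +ᴿ -ᴿ x} {fromℚ 0ℚ} λ n → ℚ.+-inverseʳ (seq x n))
            ; ⁻¹-cong = λ {x} {y} → -ᴿ-cong {x} {y}
            }
          ; comm = λ x y → pointwise {x +ᴿ y} {y +ᴿ x} λ n → ℚ.+-comm (seq x n) (seq y n)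
          }
        ; *-cong = λ {x} {x′} {y} {y′} → *ᴿ-cong {x} {x′} {y} {y′}
        ; *-assoc = λ x y z → pointwise {x *ᴿ y *ᴿ z} {x *ᴿ (y *ᴿ z)}
            λ n → ℚ.*-assoc (seq x n) (seq y n) (seq z n)
        ; *-identity = (λ x → pointwise {fromℚ 1ℚ *ᴿ x} {x} λ n → ℚ.*-identityˡ (seq x n)) ,
                       (λ x → pointwise {x *ᴿ fromℚ 1ℚ} {x} λ n → ℚ.*-identityʳ (seq x n))
        ; distrib = (λ x y z → pointwise {x *ᴿ (y +ᴿ z)} {x *ᴿ y +ᴿ x *ᴿ z}
                      λ n → ℚ.*-distribˡ-+ (seq x n) (seq y n) (seq z n)) ,
                    (λ x y z → pointwise {(y +ᴿ z) *ᴿ x} {y *ᴿ x +ᴿ z *ᴿ x}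
                      λ n → ℚ.*-distribʳ-+ (seq x n) (seq y n) (seq z n))
        }
      ; *-comm = λ x y → pointwise {x *ᴿ y} {y *ᴿ x} λ n → ℚ.*-comm (seq x n) (seq y n)
      }
    }

  -- With nonnegative terms for some representative, sums and products are
  -- handled termwise.
  NonNegᴿ : ℝ → Set
  NonNegᴿ x = ∃[ y ] x ≃ y × (∀ n → 0ℚ ℚ.≤ seq y n)

  p≤∣p∣ : ∀ p → p ℚ.≤ ℚ.∣ p ∣
  p≤∣p∣ p with ℚ.≤-total 0ℚ p
  ... | inj₁ 0≤p = ℚ.≤-reflexive (sym (ℚ.0≤p⇒∣p∣≡p 0≤p))
  ... | inj₂ p≤0 = ℚ.≤-trans p≤0 (ℚ.0≤∣p∣ p)

  -p≤∣p∣ : ∀ p → ℚ.- p ℚ.≤ ℚ.∣ p ∣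
  -p≤∣p∣ p = subst (ℚ.- p ℚ.≤_) (ℚ.∣-p∣≡∣p∣ p) (p≤∣p∣ (ℚ.- p))

  ∣p∣≤ : ∀ {p q} → p ℚ.≤ q → ℚ.- p ℚ.≤ q → ℚ.∣ p ∣ ℚ.≤ q
  ∣p∣≤ {p} {q} p≤q -p≤q with ℚ.∣p∣≡p∨∣p∣≡-p p
  ... | inj₁ eq = subst (ℚ._≤ q) (sym eq) p≤q
  ... | inj₂ eq = subst (ℚ._≤ q) (sym eq) -p≤q

  +-nonNeg : ∀ p q → 0ℚ ℚ.≤ p → 0ℚ ℚ.≤ q → 0ℚ ℚ.≤ p ℚ.+ q
  +-nonNeg p q 0≤p 0≤q = ℚ.nonNegative⁻¹ (p ℚ.+ q)
    {{ℚ.nonNeg+nonNeg⇒nonNeg p {{ℚ.nonNegative 0≤p}} q {{ℚ.nonNegative 0≤q}}}}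

  *-nonNeg : ∀ p q → 0ℚ ℚ.≤ p → 0ℚ ℚ.≤ q → 0ℚ ℚ.≤ p ℚ.* q
  *-nonNeg p q 0≤p 0≤q = ℚ.nonNegative⁻¹ (p ℚ.* q)
    {{ℚ.nonNeg*nonNeg⇒nonNeg p {{ℚ.nonNegative 0≤p}} q {{ℚ.nonNegative 0≤q}}}}

  square-nonNeg : ∀ p → 0ℚ ℚ.≤ p ℚ.* p
  square-nonNeg p = subst (0ℚ ℚ.≤_) (square≡ p) (*-nonNeg ℚ.∣ p ∣ ℚ.∣ p ∣ (ℚ.0≤∣p∣ p) (ℚ.0≤∣p∣ p))
    where
    square≡ : ∀ p → ℚ.∣ p ∣ ℚ.* ℚ.∣ p ∣ ≡ p ℚ.* p
    square≡ p with ℚ.∣p∣≡p∨∣p∣≡-p p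
    ... | inj₁ eq = cong₂ ℚ._*_ eq eq
    ... | inj₂ eq = trans (cong₂ ℚ._*_ eq eq) (solve 1 (λ p → (:- p) :* (:- p) := p :* p) refl p)

  Eventually≤ : (ℕ → ℚ) → ℚ → Set
  Eventually≤ s ε = ∃[ N ] ∀ n → N ℕ.≤ n → s n ℚ.≤ ε

  Positive : (ℕ → ℚ) → Set
  Positive s = ∃[ η ] 0ℚ ℚ.< η × ∃[ N ] ∀ n → N ℕ.≤ n → η ℚ.≤ s n

  -- Decided by the sign of s N - ε / 2, for N with tail variation ε / 4
  compare : ∀ s → IsCauchy s → ∀ ε → 0ℚ ℚ.< ε → Eventually≤ s ε ⊎ Positive s
  compare s cs ε 0<ε with cs (½ ℚ.* (½ ℚ.* ε)) (halve (halve 0<ε))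
  ... | N , p with s N ℚ.≤? ½ ℚ.* ε
  ...   | yes sN≤ = inj₁ (N , λ n N≤n → begin
            s n
              ≡⟨ solve 2 (λ a b → a := (a :- b) :+ b) refl (s n) (s N) ⟩
            (s n ℚ.- s N) ℚ.+ s N
              ≤⟨ ℚ.+-mono-≤ (ℚ.≤-trans (p≤∣p∣ _) (p n N N≤n ℕ.≤-refl)) sN≤ ⟩
            ½ ℚ.* (½ ℚ.* ε) ℚ.+ ½ ℚ.* ε
              ≤⟨ ℚ.+-monoˡ-≤ (½ ℚ.* ε) (half≤ (½ ℚ.* ε) (halve 0<ε)) ⟩
            ½ ℚ.* ε ℚ.+ ½ ℚ.* ε
              ≡⟨ halves ε ⟩
            ε ∎)
    where
    open ℚ.≤-Reasoning
    half≤ : ∀ δ → 0ℚ ℚ.< δ → ½ ℚ.* δ ℚ.≤ δ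
    half≤ δ 0<δ = subst₂ ℚ._≤_ (ℚ.+-identityʳ _) (halves δ) (ℚ.+-monoʳ-≤ (½ ℚ.* δ) (ℚ.<⇒≤ (halve 0<δ)))
  ...   | no  sN≰ = inj₂ (q , halve (halve 0<ε) , N , λ n N≤n → begin
            q
              ≡⟨ solve 1 (λ q → q := (q :+ q) :- q) refl q ⟩
            (q ℚ.+ q) ℚ.- q
              ≡⟨ cong (ℚ._- q) (halves (½ ℚ.* ε)) ⟩
            ½ ℚ.* ε ℚ.- q
              ≤⟨ ℚ.+-mono-≤ (ℚ.<⇒≤ (ℚ.≰⇒> sN≰))
                   (ℚ.neg-antimono-≤ (ℚ.≤-trans (p≤∣p∣ _) (p N n ℕ.≤-refl N≤n))) ⟩
            s N ℚ.- (s N ℚ.- s n)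
              ≡⟨ solve 2 (λ a b → a :- (a :- b) := b) refl (s N) (s n) ⟩
            s n ∎)
    where
    open ℚ.≤-Reasoning
    q = ½ ℚ.* (½ ℚ.* ε)

  null-or-apart : ∀ s → IsCauchy s → ∀ ε → 0ℚ ℚ.< ε →
    Eventually≤ (λ n → ℚ.∣ s n ∣) ε ⊎ Positive (λ n → ℚ.∣ s n ∣)
  null-or-apart s cs ε 0<ε = either (compare s cs ε 0<ε) (compare _ (cauchy (-ᴿ mkℝ s cs)) ε 0<ε)
    where
    either : Eventually≤ s ε ⊎ Positive s → Eventually≤ (λ n → ℚ.- s n) ε ⊎ Positive (λ n → ℚ.- s n) →
      Eventually≤ (λ n → ℚ.∣ s n ∣) ε ⊎ Positive (λ n → ℚ.∣ s n ∣)
    either (inj₂ (η , 0<η , N , p)) _ =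
      inj₂ (η , 0<η , N , λ n N≤n → ℚ.≤-trans (p n N≤n) (p≤∣p∣ (s n)))
    either (inj₁ _) (inj₂ (η , 0<η , N , p)) =
      inj₂ (η , 0<η , N , λ n N≤n → ℚ.≤-trans (p n N≤n) (-p≤∣p∣ (s n)))
    either (inj₁ (M , p)) (inj₁ (N , q)) = inj₁ (M ℕ.⊔ N , λ n ≤n →
      ∣p∣≤ (p n (ℕ.m⊔n≤o⇒m≤o M N ≤n)) (q n (ℕ.m⊔n≤o⇒n≤o M N ≤n)))

  null⇒≃0 : ∀ {x} → Null (seq x) → x ≃ fromℚ 0ℚ
  null⇒≃0 {x} = null-resp {seq x} {λ n → seq x n ℚ.- 0ℚ} λ n → sym (ℚ.+-identityʳ (seq x n))

  ≃0⇒null : ∀ {x} → x ≃ fromℚ 0ℚ → Null (seq x)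
  ≃0⇒null {x} = null-resp {λ n → seq x n ℚ.- 0ℚ} {seq x} λ n → ℚ.+-identityʳ (seq x n)

  -- For each `ε`, the sequence of `y` is eventually at most `ε` in absolute value or bounded away
  -- from zero. In the second case the null product forces `x` to be null, against the hypothesis.
  *ᴿ-integral : ∀ {x y} → x *ᴿ y ≃ fromℚ 0ℚ → ¬ x ≃ fromℚ 0ℚ → y ≃ fromℚ 0ℚ
  *ᴿ-integral {x} {y} xy≃0 x≄0 = null⇒≃0 {y} null
    where
    open ℚ.≤-Reasoning
    x-null : Positive (λ n → ℚ.∣ seq y n ∣) → Null (seq x)
    x-null (η , 0<η , N , apart) δ 0<δ =
      let (M , p) = ≃0⇒null {x *ᴿ y} xy≃0 (δ ℚ.* η) (*-pos {δ} {η} 0<δ 0<η) in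
      M ℕ.⊔ N , λ n ≤n → ℚ.*-cancelʳ-≤-pos {ℚ.∣ seq x n ∣} {δ} η {{ℚ.positive 0<η}} (begin
        ℚ.∣ seq x n ∣ ℚ.* η
          ≤⟨ ℚ.*-monoˡ-≤-nonNeg ℚ.∣ seq x n ∣ {{ℚ.nonNegative (ℚ.0≤∣p∣ (seq x n))}}
               (apart n (ℕ.m⊔n≤o⇒n≤o M N ≤n)) ⟩
        ℚ.∣ seq x n ∣ ℚ.* ℚ.∣ seq y n ∣
          ≡⟨ ℚ.∣p*q∣≡∣p∣*∣q∣ (seq x n) (seq y n) ⟨
        ℚ.∣ seq x n ℚ.* seq y n ∣
          ≤⟨ p n (ℕ.m⊔n≤o⇒m≤o M N ≤n) ⟩
        δ ℚ.* η ∎)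

    null : Null (seq y)
    null ε 0<ε = [ id , (λ apart → contradiction (null⇒≃0 {x} (x-null apart)) x≄0) ]′
      (null-or-apart (seq y) (cauchy y) ε 0<ε)

  nonNegᴿ-antisym : ∀ {x y} → NonNegᴿ x → NonNegᴿ y → x +ᴿ y ≃ fromℚ 0ℚ → x ≃ fromℚ 0ℚ
  nonNegᴿ-antisym {x} {y} (x′ , x≃x′ , x′≥0) (y′ , y≃y′ , y′≥0) x+y≃0 =
    ≃-trans {x} {x′} {fromℚ 0ℚ} x≃x′ (null⇒≃0 {x′} λ ε 0<ε →
      let (N , p) = ≃0⇒null {x′ +ᴿ y′} x′+y′≃0 ε 0<ε in
      N , λ n N≤n → begin
        ℚ.∣ seq x′ n ∣             ≡⟨ ℚ.0≤p⇒∣p∣≡p (x′≥0 n) ⟩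
        seq x′ n                   ≡⟨ ℚ.+-identityʳ (seq x′ n) ⟨
        seq x′ n ℚ.+ 0ℚ            ≤⟨ ℚ.+-monoʳ-≤ (seq x′ n) (y′≥0 n) ⟩
        seq x′ n ℚ.+ seq y′ n      ≤⟨ p≤∣p∣ _ ⟩
        ℚ.∣ seq x′ n ℚ.+ seq y′ n ∣ ≤⟨ p n N≤n ⟩
        ε                          ∎)
    where
    open ℚ.≤-Reasoning
    x′+y′≃0 : x′ +ᴿ y′ ≃ fromℚ 0ℚ
    x′+y′≃0 = ≃-trans {x′ +ᴿ y′} {x +ᴿ y} {fromℚ 0ℚ}
      (+ᴿ-cong {x′} {x} {y′} {y} (≃-sym {x} {x′} x≃x′) (≃-sym {y} {y′} y≃y′)) x+y≃0

  ℝ-orderedDomain : OrderedDomain ℝ-rawRing 0ℓ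
  ℝ-orderedDomain = record
    { isCommutativeRing = CommutativeRing.isCommutativeRing ℝ-commutativeRing
    ; NonNeg          = NonNegᴿ
    ; nonNeg-resp     = λ {x} {y} x≃y (z , x≃z , z≥0) →
        z , ≃-trans {y} {x} {z} (≃-sym {x} {y} x≃y) x≃z , z≥0
    ; nonNeg-+        = λ {x} {y} (x′ , x≃x′ , x′≥0) (y′ , y≃y′ , y′≥0) →
        x′ +ᴿ y′ , +ᴿ-cong {x} {x′} {y} {y′} x≃x′ y≃y′ ,
        λ n → +-nonNeg (seq x′ n) (seq y′ n) (x′≥0 n) (y′≥0 n)
    ; nonNeg-*        = λ {x} {y} (x′ , x≃x′ , x′≥0) (y′ , y≃y′ , y′≥0) →
        x′ *ᴿ y′ , *ᴿ-cong {x} {x′} {y} {y′} x≃x′ y≃y′ ,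
        λ n → *-nonNeg (seq x′ n) (seq y′ n) (x′≥0 n) (y′≥0 n)
    ; nonNeg-square   = λ x → x *ᴿ x , pointwise {x *ᴿ x} {x *ᴿ x} (λ _ → refl) , λ n → square-nonNeg (seq x n)
    ; nonNeg-antisym  = λ {x} {y} → nonNegᴿ-antisym {x} {y}
    ; integral        = λ {x} {y} → *ᴿ-integral {x} {y}
    ; 1≉0             = λ 1≃0 → let (N , p) = 1≃0 ½ (ℚ.positive⁻¹ ½) in
        from-no (ℚ.∣ 1ℚ ℚ.- 0ℚ ∣ ℚ.≤? ½) (p N ℕ.≤-refl)
    }

  -- Positivity holds only from `N` on, while `NonNegᴿ` wants every term nonnegative; the
  -- representative drops the first `N` terms.
  positive⇒nonNegᴿ : ∀ {x} → Positive (seq x) → NonNegᴿ x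
  positive⇒nonNegᴿ {x} (η , 0<η , N , p) =
    mkℝ (λ n → seq x (N ℕ.+ n)) (λ ε 0<ε → let (M , q) = cauchy x ε 0<ε in
      M , λ m n M≤m M≤n → q (N ℕ.+ m) (N ℕ.+ n) (ℕ.m≤n⇒m≤o+n N M≤m) (ℕ.m≤n⇒m≤o+n N M≤n)) ,
    (λ ε 0<ε → let (M , q) = cauchy x ε 0<ε in
      M , λ n M≤n → q n (N ℕ.+ n) M≤n (ℕ.m≤n⇒m≤o+n N M≤n)) ,
    λ n → ℚ.≤-trans (ℚ.<⇒≤ 0<η) (p (N ℕ.+ n) (ℕ.m≤m+n N n))

  positive⇒≄0 : ∀ {x} → Positive (seq x) → ¬ x ≃ fromℚ 0ℚ
  positive⇒≄0 {x} (η , 0<η , N , p) x≃0 =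
    let (M , q) = ≃0⇒null {x} x≃0 (½ ℚ.* η) (halve 0<η)
        n = M ℕ.⊔ N
        η≤ = bound n (ℕ.m≤m⊔n M N) (ℕ.m≤n⊔m M N) q
    in ℚ.<-irrefl refl (ℚ.<-≤-trans 0<η (begin
      η                             ≡⟨ solve 1 (λ η → η := (η :+ η) :- η) refl η ⟩
      (η ℚ.+ η) ℚ.- η               ≤⟨ ℚ.+-monoˡ-≤ (ℚ.- η) (ℚ.+-mono-≤ η≤ η≤) ⟩
      (½ ℚ.* η ℚ.+ ½ ℚ.* η) ℚ.- η   ≡⟨ cong (ℚ._- η) (halves η) ⟩
      η ℚ.- η                       ≡⟨ ℚ.+-inverseʳ η ⟩
      0ℚ                            ∎))
    where
    open ℚ.≤-Reasoning
    bound : ∀ n {M} → M ℕ.≤ n → N ℕ.≤ n → (∀ n → M ℕ.≤ n → ℚ.∣ seq x n ∣ ℚ.≤ ½ ℚ.* η) → η ℚ.≤ ½ ℚ.* η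
    bound n M≤n N≤n q = ℚ.≤-trans (p n N≤n) (ℚ.≤-trans (p≤∣p∣ _) (q n M≤n))

-- Comparison with the ordered list of degrees

all-take-tabulate : ∀ {a p} {A : Set a} {P : Pred A p} {n} k (f : Fin n → A) →
  (∀ i → toℕ i ℕ.< k → P (f i)) → All P (take k (tabulate f))
all-take-tabulate {n = n}     zero    f p = []
all-take-tabulate {n = zero}  (suc k) f p = []
all-take-tabulate {n = suc n} (suc k) f p =
  p zero ℕ.z<s ∷ all-take-tabulate k (f ∘ suc) λ i i<k → p (suc i) (ℕ.s<s i<k)

module DegreeBound {c ℓ p} {R : RawRing c ℓ} (D : OrderedDomain R p) where
  open OrderedDomain D
  open IntegerSolver commutativeRing
  open Polynomials D
  open Algebra.Properties.Semiring.Sum semiring using (sum)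
  open Relation.Binary.Reasoning.Setoid setoid

  module _ (ι : ℤ → Carrier)
    (ι-0 : ι (ℤ.+ 0) ≈ 0#)
    (ι-+ : ∀ a b → ι (ℤ.+ a) + ι (ℤ.+ b) ≈ ι (ℤ.+ (a ℕ.+ b)))
    (ι-neg : ∀ k → ι -[1+ k ] ≈ - ι (ℤ.+ suc k))
    (ι-nonNeg : ∀ k → NonNeg (ι (ℤ.+ k)))
    where

    ι-sum : ∀ {n} (f : Fin n → ℕ) →
      sum (λ i → ι (ℤ.+ f i)) ≈ ι (ℤ.+ RawMonoidDefinitions.sum ℕ.+-0-rawMonoid f)
    ι-sum {zero}  f = sym ι-0
    ι-sum {suc n} f = trans (+-congˡ (ι-sum (f ∘ suc))) (ι-+ (f zero) _)

    ι-∸ : ∀ {a b} → a ℕ.≤ b → ι (ℤ.+ (b ℕ.∸ a)) ≈ ι (ℤ.+ b) - ι (ℤ.+ a)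
    ι-∸ {a} {b} a≤b = begin
      ι (ℤ.+ (b ℕ.∸ a))
        ≈⟨ solve 2 (λ q p → q := (q :+ p) :- p) refl _ (ι (ℤ.+ a)) ⟩
      (ι (ℤ.+ (b ℕ.∸ a)) + ι (ℤ.+ a)) - ι (ℤ.+ a)
        ≈⟨ +-congʳ (trans (ι-+ (b ℕ.∸ a) a) (reflexive (≡.cong (λ k → ι (ℤ.+ k)) (ℕ.m∸n+n≡m a≤b)))) ⟩
      ι (ℤ.+ b) - ι (ℤ.+ a) ∎

    ι-∣∣ : ∀ z → ι z ≈ ι (ℤ.+ ℤ.∣ z ∣) ⊎ ι z ≈ - ι (ℤ.+ ℤ.∣ z ∣)
    ι-∣∣ (ℤ.+ k)  = inj₁ refl
    ι-∣∣ -[1+ k ] = inj₂ (ι-neg k)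

    product-monicProduct : ∀ {n} (μ : Vector Carrier n) t →
      RawSemiringDefinitions.product (RawRing.rawSemiring R) (λ i → t + - μ i) ≡
      monicProduct (tabulate μ) t
    product-monicProduct {zero}  μ t = ≡.refl
    product-monicProduct {suc n} μ t = ≡.cong ((t - μ zero) *_) (product-monicProduct (μ ∘ suc) t)

    eigenvalues-not-above-degree : ∀ {n} (A : Matrix ℤ n) → (∀ i j → A i j ≡ A j i) →
      ∀ μ δ → Eigenvalues R (λ i j → ι (A i j)) μ → DescendingDegrees A δ →
      ∀ j → let d = ι (ℤ.+ δ j) in
      ¬ (∀ i → i Fin.≤ j → NonNeg (μ i - d) × ¬ μ i - d ≈ 0#)
    eigenvalues-not-above-degree {n} A A-symmetric μ δ eigenvalues ((π , δ≡) , δ-desc) j above =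
      few-eigenvalues-above d W (λ i k → ι-nonNeg ℤ.∣ A i k ∣)
        (λ i k → ι-cong (≡.cong (λ z → ℤ.+ ℤ.∣ z ∣) (A-symmetric i k))) (λ i k → ι-∣∣ (A i k))
        S small (take (suc (toℕ j)) (tabulate μ)) (drop (suc (toℕ j)) (tabulate μ))
        (all-take-tabulate (suc (toℕ j)) μ λ i i≤j → above i (ℕ.s≤s⁻¹ i≤j))
        factored
        (ℕ.≤-reflexive (≡.sym (≡.trans (List.length-take (suc (toℕ j)) (tabulate μ))
          (≡.trans (≡.cong (suc (toℕ j) ℕ.⊓_) (List.length-tabulate μ)) (ℕ.m≤n⇒m⊓n≡m (Fin.toℕ<n j))))))
      where
      ι-cong : ∀ {y z} → y ≡ z → ι y ≈ ι z
      ι-cong eq = reflexive (≡.cong ι eq)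

      open EigenvalueBound D (λ i k → ι (A i k)) (λ i k → ι-cong (A-symmetric i k))

      d : Carrier
      d = ι (ℤ.+ δ j)

      W : Matrix Carrier n
      W i k = ι (ℤ.+ ℤ.∣ A i k ∣)

      -- Indices start at zero: the `toℕ j` places before `j` carry the largest degrees, whereas
      -- `suc (toℕ j)` eigenvalues, that of `j` included, are assumed above `d`.
      S : Fin (toℕ j) → Fin n
      S s = π ⟨$⟩ʳ inject s

      small : ∀ i → (∃[ s ] S s ≡ i) ⊎ NonNeg (d - sum (W i))
      -- An index outside `S` stands at place `j` or later in the descending list, so its degree is
      -- at most `δ j`.
      small i with toℕ (π ⟨$⟩ˡ i) ℕ.<? toℕ j
      ... | yes k<j = inj₁ (fromℕ< k<j , ≡.trans
              (≡.cong (π ⟨$⟩ʳ_) (Fin.toℕ-injective (≡.trans (Fin.toℕ-inject (fromℕ< k<j)) (Fin.toℕ-fromℕ< k<j))))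
              (inverseʳ π))
      ... | no  k≮j = inj₂ (nonNeg-resp
              (trans (ι-∸ degree≤) (+-congˡ (-‿cong (sym (ι-sum (λ k → ℤ.∣ A i k ∣))))))
              (ι-nonNeg (δ j ℕ.∸ degree A i)))
        where
        degree≤ : degree A i ℕ.≤ δ j
        degree≤ = ≡.subst (ℕ._≤ δ j) (≡.trans (δ≡ (π ⟨$⟩ˡ i)) (≡.cong (degree A) (inverseʳ π)))
          (δ-desc (ℕ.≮⇒≥ k≮j))

      factored : ∀ t → charPoly R (λ i k → ι (A i k)) t ≈
        monicProduct (take (suc (toℕ j)) (tabulate μ) ++ drop (suc (toℕ j)) (tabulate μ)) t
      factored t = trans (eigenvalues t) (reflexive (≡.trans (product-monicProduct μ t)
        (≡.cong (λ as → monicProduct as t) (≡.sym (List.take++drop≡id (suc (toℕ j)) (tabulate μ))))))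

-- The bound for symmetric integer matrices over the reals

module RealEigenvalues where
  open ≡
  open RealNumbers

  -- Both summands are rewritten to normal form with denominator 1, after which rational addition
  -- computes.
  ℕ/1-+ : ∀ a b → ℤ.+ a ℚ./ 1 ℚ.+ ℤ.+ b ℚ./ 1 ≡ ℤ.+ (a ℕ.+ b) ℚ./ 1
  ℕ/1-+ a b = trans
    (cong₂ ℚ._+_ (ℚ.normalize-coprime (coprime a)) (ℚ.normalize-coprime (coprime b)))
    (cong (ℚ._/ 1) (cong₂ ℤ._+_ (ℤ.*-identityʳ (ℤ.+ a)) (ℤ.*-identityʳ (ℤ.+ b))))
    where
    coprime : ∀ k → Coprime.Coprime k 1
    coprime k = Coprime.sym (Coprime.1-coprimeTo k)

  -- Half of the margin `η` pays for the slack in `x ≤ᴿ y`; the other half remains.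
  positive-mono : ∀ {x y} d → x ≤ᴿ y → Positive (seq (x +ᴿ -ᴿ d)) → Positive (seq (y +ᴿ -ᴿ d))
  positive-mono {x} {y} d x≤y (η , 0<η , N , p) =
    let (M , q) = x≤y (½ ℚ.* η) (halve 0<η) in
    ½ ℚ.* η , halve 0<η , M ℕ.⊔ N , λ n ≤n → begin
      h                                  ≡⟨ solve 1 (λ h → h := (h :+ h) :- h) refl h ⟩
      (h ℚ.+ h) ℚ.- h                    ≡⟨ cong (ℚ._- h) (halves η) ⟩
      η ℚ.- h                            ≤⟨ ℚ.+-monoˡ-≤ (ℚ.- h) (p n (ℕ.m⊔n≤o⇒n≤o M N ≤n)) ⟩
      (seq x n ℚ.- seq d n) ℚ.- h        ≤⟨ ℚ.+-monoˡ-≤ (ℚ.- h) (ℚ.+-monoˡ-≤ (ℚ.- seq d n) (q n (ℕ.m⊔n≤o⇒m≤o M N ≤n))) ⟩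
      (seq y n ℚ.+ h ℚ.- seq d n) ℚ.- h  ≡⟨ solve 3 (λ y h d → (y :+ h :- d) :- h := y :- d) refl (seq y n) h (seq d n) ⟩
      seq y n ℚ.- seq d n                ∎
    where
    open ℚ.≤-Reasoning
    open +-*-Solver
    h = ½ ℚ.* η

  -- The order is a negative statement: `compare` yields either the required estimate or the
  -- excluded positivity. This discharges the double negations of the algebraic part.
  ≤ᴿ-stable : ∀ {x d} → ¬ Positive (seq (x +ᴿ -ᴿ d)) → x ≤ᴿ d
  ≤ᴿ-stable {x} {d} ¬pos ε 0<ε = [ close , (λ pos → contradiction pos ¬pos) ]′
    (compare (seq (x +ᴿ -ᴿ d)) (cauchy (x +ᴿ -ᴿ d)) ε 0<ε)
    where
    open ℚ.≤-Reasoning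
    open +-*-Solver
    close : Eventually≤ (seq (x +ᴿ -ᴿ d)) ε → ∃[ N ] ∀ n → N ℕ.≤ n → seq x n ℚ.≤ seq d n ℚ.+ ε
    close (N , p) = N , λ n N≤n → begin
      seq x n                              ≡⟨ solve 2 (λ x d → x := d :+ (x :- d)) refl (seq x n) (seq d n) ⟩
      seq d n ℚ.+ (seq x n ℚ.- seq d n)    ≤⟨ ℚ.+-monoʳ-≤ (seq d n) (p n N≤n) ⟩
      seq d n ℚ.+ ε                        ∎

  fromℤ-+ : ∀ a b → fromℤ (ℤ.+ a) +ᴿ fromℤ (ℤ.+ b) ≃ fromℤ (ℤ.+ (a ℕ.+ b))
  fromℤ-+ a b = pointwise {fromℕ a +ᴿ fromℕ b} {fromℕ (a ℕ.+ b)} λ _ → ℕ/1-+ a b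

  fromℤ-neg : ∀ k → fromℤ -[1+ k ] ≃ -ᴿ fromℤ (ℤ.+ suc k)
  fromℤ-neg k = pointwise {fromℤ -[1+ k ]} { -ᴿ fromℤ (ℤ.+ suc k)} λ _ → refl

  fromℕ-nonNeg : ∀ k → NonNegᴿ (fromℕ k)
  fromℕ-nonNeg k = fromℕ k , pointwise {fromℕ k} {fromℕ k} (λ _ → refl) ,
    λ _ → ℚ.nonNegative⁻¹ (ℤ.+ k ℚ./ 1) {{ℚ.normalize-nonNeg k 1}}

  fromℤ-0 : fromℤ (ℤ.+ 0) ≃ fromℚ 0ℚ
  fromℤ-0 = pointwise {fromℤ (ℤ.+ 0)} {fromℚ 0ℚ} λ _ → refl

  eigenvalue≤degree : ∀ {n} (A : Matrix ℤ n) → (∀ i j → A i j ≡ A j i) →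
    ∀ μ δ → DescendingEigenvalues A μ → DescendingDegrees A δ → ∀ j → μ j ≤ᴿ fromℕ (δ j)
  eigenvalue≤degree {n} A A-symmetric μ δ (eigenvalues , μ-desc) degrees j =
    ≤ᴿ-stable {μ j} {d} λ pos →
      DegreeBound.eigenvalues-not-above-degree ℝ-orderedDomain fromℤ fromℤ-0 fromℤ-+ fromℤ-neg fromℕ-nonNeg
        A A-symmetric μ δ eigenvalues degrees j λ i i≤j →
        -- The descending order spreads the assumed excess of `μ j` over `d` to all earlier
        -- eigenvalues.
        let pos′ = positive-mono {μ j} {μ i} d (μ-desc i≤j) pos in
        positive⇒nonNegᴿ {μ i +ᴿ -ᴿ d} pos′ , positive⇒≄0 {μ i +ᴿ -ᴿ d} pos′
    where
    d : ℝ
    d = fromℕ (δ j)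

-- Dirac matrices of complexes and open sets

theorem3 : ∀ {m n} (G : SimplicialComplex m n) (O : VertexOrdering G) →
    (∀ λs ds → DescendingEigenvalues (dirac G O) λs →
    DescendingDegrees (dirac G O) ds →
    ∀ j → λs j ≤ᴿ fromℕ (ds j))
    ×
    (∀ (U : Subset n) → Open G U →
    ∀ λs ds → DescendingEigenvalues (diracOn G O U) λs →
    DescendingDegrees (diracOn G O U) ds →
    ∀ j → λs j ≤ᴿ fromℕ (ds j))
theorem3 G O =
  RealEigenvalues.eigenvalue≤degree (dirac G O) dirac-symmetric ,
  λ U _ → RealEigenvalues.eigenvalue≤degree (diracOn G O U) (λ _ _ → dirac-symmetric _ _)
  where
  dirac-symmetric : ∀ x y → dirac G O x y ≡ dirac G O y x
  dirac-symmetric x y = ℤ.+-comm (exteriorDerivative G O x y) (exteriorDerivative G O y x)
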